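{- Let $q$ be an odd power of an odd prime and let $r\ge1$ be an integer. If there is a $\mu\in\mathbb{F}_q$ such that $x^{2r+1}-\mu$ is irreducible in $\mathbb{F}_q[x]$, then \[ \chi(ER_{q^{2r+1}})\le \frac{2r+5}{3}\,q^{\frac{4r}{3}+1}+(2r+1)q^{r+1}+1. \]
   Context: For a prime power $Q$, $ER_Q$ is the graph whose vertices are the points of $PG(2,Q)$, i.e. the $1$-dimensional subspaces of $\mathbb{F}_Q^3$, where distinct vertices $(x_0,x_1,x_2)$ and $(y_0,y_1,y_2)$ (homogeneous coordinates) are adjacent if and only if $x_0y_0+x_1y_1+x_2y_2=0$. $\chi$ denotes the chromatic number. -}

module Defs where

open import Algebra.Bundles using (CommutativeRing; RawSemiring)
import Algebra.Definitions.RawSemiring as RawSemiringDefinitions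
open import Data.Fin.Base using (Fin; zero; suc; finToFun; funToFin)
import Data.Fin.Properties as Fin
open import Data.Integer.Base using (+_)
open import Data.List.Base using (List; []; _∷_; map)
open import Data.Nat.Base using (ℕ; zero; suc; NonZero; _≤_; z≤n)
import Data.Nat.Base as ℕ
open import Data.Nat.Divisibility using (_∣_)
import Data.Nat.Properties as ℕₚ
open import Data.Nat.Primality using (Prime)
open import Data.Product.Base using (Σ; ∃; ∃₂; _×_; _,_; proj₁; proj₂)
open import Data.Rational.Base using (ℚ; 0ℚ)
import Data.Rational.Base as ℚ
open import Data.Vec.Functional using (Vector)
open import Function.Base using (_∘_)
open import Function.Bundles using (Func; Inverse; _⟨$⟩_)
open import Level using (Level; _⊔_)
open import Relation.Binary.Bundles using (Setoid)
open import Relation.Binary.Definitions using (Decidable; Symmetric; _Respects₂_)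
open import Relation.Binary.PropositionalEquality as ≡ using (_≡_; _≢_)
import Relation.Binary.Reasoning.Setoid as SetoidReasoning
open import Relation.Nullary using (¬_; Dec; yes; no; contradiction)
open import Relation.Nullary.Decidable using (map′; _×-dec_; _→-dec_; ¬?)

private variable
  c ℓ a : Level

------------------------------------------------------------------------
-- Odd powers of odd primes

Odd : ℕ → Set
Odd n = ¬ (2 ∣ n)

OddPowerOfOddPrime : ℕ → Set
OddPowerOfOddPrime q =
  ∃₂ λ p e → Prime p × Odd p × Odd e × q ≡ p ℕ.^ e

------------------------------------------------------------------------
-- Fractional powers

fromℕ : ℕ → ℚ
fromℕ n = + n ℚ./ 1

infixr 8 _^ℚ_
_^ℚ_ : ℚ → ℕ → ℚ
_^ℚ_ = RawSemiringDefinitions._^_ ℚ.+-*-rawSemiring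

-- The rational t is an upper bound of the real number q^(m/n).  Since a real
-- number is the infimum of its rational upper bounds, for rationals x, a, b
-- with a ≥ 0 the real inequality  x ≤ a q^(m/n) + b  is the assertion that
-- x ≤ a t + b  for every t with  q ^[ m / n ]≤ t.
_^[_/_]≤_ : (q m n : ℕ) .{{_ : NonZero n}} → ℚ → Set
q ^[ m / n ]≤ t = 0ℚ ℚ.≤ t × fromℕ (q ℕ.^ m) ℚ.≤ t ^ℚ n

------------------------------------------------------------------------
-- Finite fields

record FiniteField c ℓ (order : ℕ) : Set (Level.suc (c ⊔ ℓ)) where
  field
    commutativeRing : CommutativeRing c ℓ

  open CommutativeRing commutativeRing public

  field
    1≉0         : ¬ (1# ≈ 0#)
    invertible  : ∀ x → ¬ (x ≈ 0#) → ∃ λ y → x * y ≈ 1#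
    enumeration : Inverse (≡.setoid (Fin order)) setoid

  private module E = Inverse enumeration

  infix 4 _≈?_
  _≈?_ : Decidable _≈_
  x ≈? y = map′
    (λ eq → trans (sym (E.strictlyInverseˡ x))
                  (trans (E.to-cong eq) (E.strictlyInverseˡ y)))
    E.from-cong
    (E.from x Fin.≟ E.from y)

  ∃? : {P : Carrier → Set a} → (∀ {x y} → x ≈ y → P x → P y) →
       (∀ x → Dec (P x)) → Dec (∃ P)
  ∃? resp P? = map′
    (λ (i , p) → E.to i , p)
    (λ (x , p) → E.from x , resp (sym (E.strictlyInverseˡ x)) p)
    (Fin.any? (λ i → P? (E.to i)))

------------------------------------------------------------------------
-- Polynomials, as lists of coefficients in ascending degree; trailing
-- zeros are identified by comparing coefficients.

module Polynomial (R : CommutativeRing c ℓ) where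
  private module R = CommutativeRing R

  Poly : Set c
  Poly = List R.Carrier

  coeff : Poly → ℕ → R.Carrier
  coeff []      _       = R.0#
  coeff (a ∷ p) zero    = a
  coeff (a ∷ p) (suc n) = coeff p n

  infix 4 _≈_
  _≈_ : Poly → Poly → Set ℓ
  p ≈ q = ∀ n → coeff p n R.≈ coeff q n

  infixl 6 _+_
  _+_ : Poly → Poly → Poly
  []      + q       = q
  (a ∷ p) + []      = a ∷ p
  (a ∷ p) + (b ∷ q) = (a R.+ b) ∷ (p + q)

  infixl 7 _*_
  _*_ : Poly → Poly → Poly
  []      * q = []
  (a ∷ p) * q = map (a R.*_) q + (R.0# ∷ (p * q))

  constant : R.Carrier → Poly
  constant a = a ∷ []

  X : Poly
  X = R.0# ∷ R.1# ∷ []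

  rawSemiring : RawSemiring c ℓ
  rawSemiring = record
    { Carrier = Poly
    ; _≈_     = _≈_
    ; _+_     = _+_
    ; _*_     = _*_
    ; 0#      = []
    ; 1#      = constant R.1#
    }

  open RawSemiringDefinitions rawSemiring public using (_^_; Irreducible)

  X^_-_ : ℕ → R.Carrier → Poly
  X^ n - μ = X ^ n + constant (R.- μ)

------------------------------------------------------------------------
-- Finite simple graphs and the chromatic number

-- `vertex` may list a vertex several times.
record FiniteGraph c ℓ a : Set (Level.suc (c ⊔ ℓ ⊔ a)) where
  infix 4 _~_
  field
    vertices : Setoid c ℓ

  open Setoid vertices public

  field
    _~_           : Carrier → Carrier → Set a
    ~-resp-≈      : _~_ Respects₂ _≈_
    ~-sym         : Symmetric _~_
    ~-irrefl      : ∀ {u v} → u ~ v → ¬ (u ≈ v)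
    _≈?_          : Decidable _≈_
    _~?_          : Decidable _~_
    size          : ℕ
    vertex        : Fin size → Carrier
    vertex-covers : ∀ v → ∃ λ i → vertex i ≈ v

module _ (G : FiniteGraph c ℓ a) where
  open FiniteGraph G

  Colourable : ℕ → Set (c ⊔ ℓ ⊔ a)
  Colourable k = Σ (Func vertices (≡.setoid (Fin k))) λ f →
    ∀ {u v} → u ~ v → f ⟨$⟩ u ≢ f ⟨$⟩ v

  IsChromaticNumber : ℕ → Set (c ⊔ ℓ ⊔ a)
  IsChromaticNumber k = Colourable k × (∀ m → Colourable m → k ≤ m)

  private
    Good : ∀ {k} → (Fin size → Fin k) → Set (ℓ ⊔ a)
    Good g = ∀ i j →
      (vertex i ≈ vertex j → g i ≡ g j) × (vertex i ~ vertex j → g i ≢ g j)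

    good? : ∀ {k} (g : Fin size → Fin k) → Dec (Good g)
    good? g = Fin.all? λ i → Fin.all? λ j →
      ((vertex i ≈? vertex j) →-dec (g i Fin.≟ g j)) ×-dec
      ((vertex i ~? vertex j) →-dec ¬? (g i Fin.≟ g j))

    good-resp : ∀ {k} {g h : Fin size → Fin k} →
                (∀ i → g i ≡ h i) → Good g → Good h
    good-resp eq good i j =
      (λ e → ≡.trans (≡.sym (eq i)) (≡.trans (proj₁ (good i j) e) (eq j))) ,
      (λ e h → proj₂ (good i j) e
        (≡.trans (eq i) (≡.trans h (≡.sym (eq j)))))

    index : Carrier → Fin size
    index v = proj₁ (vertex-covers v)

    index-≈ : ∀ v → vertex (index v) ≈ v
    index-≈ v = proj₂ (vertex-covers v)

    good⇒colourable : ∀ {k} {g : Fin size → Fin k} → Good g → Colourable k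
    good⇒colourable {g = g} good =
      record
        { to   = g ∘ index
        ; cong = λ {u} {v} u≈v → proj₁ (good (index u) (index v))
                   (trans (index-≈ u) (trans u≈v (sym (index-≈ v))))
        } ,
      λ {u} {v} u~v → proj₂ (good (index u) (index v))
        (proj₂ ~-resp-≈ (sym (index-≈ u))
          (proj₁ ~-resp-≈ (sym (index-≈ v)) u~v))

    colourable⇒good : ∀ {k} ((f , _) : Colourable k) →
                      Good (λ i → f ⟨$⟩ vertex i)
    colourable⇒good (f , proper) i j = Func.cong f , proper

    colourable? : ∀ k → Dec (Colourable k)
    colourable? k = map′
      (λ (_ , good) → good⇒colourable good)
      (λ col → funToFin (λ i → proj₁ col ⟨$⟩ vertex i) ,
        good-resp (λ i → ≡.sym (Fin.finToFun-funToFin (λ i → proj₁ col ⟨$⟩ vertex i) i))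
          (colourable⇒good col))
      (Fin.any? {k ℕ.^ size} (λ n → good? (finToFun n)))

    find : ∀ {n} (w : Fin n → Carrier) v → (∃ λ i → w i ≈ v) → Fin n
    find {suc n} w v e with w zero ≈? v
    find {suc n} w v e             | yes _ = zero
    find {suc n} w v (zero  , p)   | no ¬p = contradiction p ¬p
    find {suc n} w v (suc i , p)   | no ¬p = suc (find (w ∘ suc) v (i , p))

    find-≈ : ∀ {n} (w : Fin n → Carrier) v e → w (find w v e) ≈ v
    find-≈ {suc n} w v e with w zero ≈? v
    find-≈ {suc n} w v e           | yes p = p
    find-≈ {suc n} w v (zero  , p) | no ¬p = contradiction p ¬p
    find-≈ {suc n} w v (suc i , p) | no ¬p = find-≈ (w ∘ suc) v (i , p)

    find-cong : ∀ {n} (w : Fin n → Carrier) {u v} d e →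
                u ≈ v → find w u d ≡ find w v e
    find-cong {suc n} w {u} {v} d e u≈v with w zero ≈? u | w zero ≈? v
    ... | yes _ | yes _ = ≡.refl
    ... | yes p | no ¬q = contradiction (trans p u≈v) ¬q
    ... | no ¬p | yes q = contradiction (trans q (sym u≈v)) ¬p
    find-cong {suc n} w (zero , p)  _           _ | no ¬p | no _  =
      contradiction p ¬p
    find-cong {suc n} w (suc _ , _) (zero  , q) _ | no _  | no ¬q =
      contradiction q ¬q
    find-cong {suc n} w (suc i , p) (suc j , q) u≈v | no _ | no _ =
      ≡.cong suc (find-cong (w ∘ suc) (i , p) (j , q) u≈v)

    size-colourable : Colourable size
    size-colourable =
      record
        { to   = λ v → find vertex v (vertex-covers v)
        ; cong = λ {u} {v} → find-cong vertex (vertex-covers u) (vertex-covers v)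
        } ,
      λ {u} {v} u~v eq → ~-irrefl u~v
        (trans (sym (find-≈ vertex u (vertex-covers u)))
          (trans (reflexive (≡.cong vertex eq))
            (find-≈ vertex v (vertex-covers v))))

    least : ∀ n k → (∀ m → Colourable m → k ≤ m) → Colourable (n ℕ.+ k) →
            ∃ IsChromaticNumber
    least zero    k lower col = k , col , lower
    least (suc n) k lower col with colourable? k
    ... | yes colₖ = k , colₖ , lower
    ... | no ¬colₖ = least n (suc k)
      (λ m colₘ → ℕₚ.≤∧≢⇒< (lower m colₘ) λ { ≡.refl → ¬colₖ colₘ })
      (≡.subst Colourable (≡.sym (ℕₚ.+-suc n k)) col)

  chromaticNumber : ∃ IsChromaticNumber
  chromaticNumber = least size 0 (λ _ _ → z≤n)
    (≡.subst Colourable (≡.sym (ℕₚ.+-identityʳ size)) size-colourable)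

  χ : ℕ
  χ = proj₁ chromaticNumber

------------------------------------------------------------------------
-- The graph ER_Q

module _ {Q : ℕ} (K : FiniteField c ℓ Q) where
  open FiniteField K hiding (zero)
  private
    module E = Inverse enumeration
    open SetoidReasoning setoid

    i₀ i₁ i₂ : Fin 3
    i₀ = zero
    i₁ = suc zero
    i₂ = suc (suc zero)

  Nonzero : Vector Carrier 3 → Set ℓ
  Nonzero x = ¬ (∀ i → x i ≈ 0#)

  _∝_ : Vector Carrier 3 → Vector Carrier 3 → Set (c ⊔ ℓ)
  x ∝ y = ∃ λ s → ¬ (s ≈ 0#) × (∀ i → x i ≈ s * y i)

  dot : Vector Carrier 3 → Vector Carrier 3 → Carrier
  dot x y = x i₀ * y i₀ + x i₁ * y i₁ + x i₂ * y i₂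

  private
    cancel : ∀ {s t u} → s * t ≈ 1# → s * (t * u) ≈ u
    cancel st≈1 = trans (sym (*-assoc _ _ _))
      (trans (*-congʳ st≈1) (*-identityˡ _))

    unit≉0 : ∀ {s t} → s * t ≈ 1# → ¬ (t ≈ 0#)
    unit≉0 st≈1 t≈0 = 1≉0
      (trans (sym st≈1) (trans (*-congˡ t≈0) (zeroʳ _)))

    ∝-pointwise : ∀ {x y} → (∀ i → x i ≈ y i) → x ∝ y
    ∝-pointwise eq = 1# , 1≉0 , λ i → trans (eq i) (sym (*-identityˡ _))

    ∝-sym : Symmetric _∝_
    ∝-sym {x} {y} (s , s≉0 , eq) =
      let t , st≈1 = invertible s s≉0
          ts≈1     = trans (*-comm t s) st≈1
      in t , unit≉0 st≈1 , λ i → sym (trans (*-congˡ (eq i)) (cancel ts≈1))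

    ∝-trans : ∀ {x y z} → x ∝ y → y ∝ z → x ∝ z
    ∝-trans (s , s≉0 , eq₁) (t , t≉0 , eq₂) =
      s * t ,
      (λ st≈0 → t≉0 (trans (sym (cancel s⁻¹s≈1))
        (trans (*-congˡ st≈0) (zeroʳ _)))) ,
      λ i → trans (eq₁ i) (trans (*-congˡ (eq₂ i)) (sym (*-assoc _ _ _)))
      where
      s⁻¹s≈1 = trans (*-comm _ _) (proj₂ (invertible s s≉0))

    _∝?_ : Decidable _∝_
    x ∝? y = ∃?
      (λ s≈t (s≉0 , eq) →
        (λ t≈0 → s≉0 (trans s≈t t≈0)) , λ i → trans (eq i) (*-congʳ s≈t))
      (λ s → ¬? (s ≈? 0#) ×-dec Fin.all? (λ i → x i ≈? (s * y i)))

    dot-comm : ∀ x y → dot x y ≈ dot y x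
    dot-comm x y =
      +-cong (+-cong (*-comm _ _) (*-comm _ _)) (*-comm _ _)

    dot-scale : ∀ {x y} z ((s , _) : x ∝ y) → dot x z ≈ s * dot y z
    dot-scale {x} {y} z (s , _ , eq) = begin
      dot x z
        ≈⟨ +-cong (+-cong (term i₀) (term i₁)) (term i₂) ⟩
      s * (y i₀ * z i₀) + s * (y i₁ * z i₁) + s * (y i₂ * z i₂)
        ≈⟨ +-congʳ (distribˡ _ _ _) ⟨
      s * (y i₀ * z i₀ + y i₁ * z i₁) + s * (y i₂ * z i₂)
        ≈⟨ distribˡ _ _ _ ⟨
      s * dot y z ∎
      where
      term : ∀ i → x i * z i ≈ s * (y i * z i)
      term i = trans (*-congʳ (eq i)) (*-assoc _ _ _)

    dot-resp : ∀ {x y} z → x ∝ y → dot y z ≈ 0# → dot x z ≈ 0#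
    dot-resp z x∝y yz≈0 =
      trans (dot-scale z x∝y) (trans (*-congˡ yz≈0) (zeroʳ _))

  -- A one-dimensional subspace of K³ is given by a vector spanning it; two
  -- vectors span the same subspace when each is a nonzero multiple of the other.
  Points : Setoid (c ⊔ ℓ) (c ⊔ ℓ)
  Points = record
    { Carrier       = Σ (Vector Carrier 3) Nonzero
    ; _≈_           = λ (x , _) (y , _) → x ∝ y
    ; isEquivalence = record
      { refl  = ∝-pointwise (λ _ → refl)
      ; sym   = ∝-sym
      ; trans = ∝-trans
      }
    }

  Point : Set (c ⊔ ℓ)
  Point = Setoid.Carrier Points

  _~_ : Point → Point → Set (c ⊔ ℓ)
  (x , _) ~ (y , _) = ¬ (x ∝ y) × dot x y ≈ 0#

  private

    ~-sym : Symmetric _~_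
    ~-sym {x , _} {y , _} (x≢y , xy≈0) =
      x≢y ∘ ∝-sym , trans (dot-comm y x) xy≈0

    ~-respˡ : ∀ {u v w} → Setoid._≈_ Points v w → v ~ u → w ~ u
    ~-respˡ {u , _} {v , _} {w , _} v∝w (v≢u , vu≈0) =
      v≢u ∘ ∝-trans v∝w , dot-resp u (∝-sym v∝w) vu≈0

    -- The zero vector spans no point and is sent to (1,1,1) instead.
    toPoint : (x : Vector Carrier 3) → Dec (∀ i → x i ≈ 0#) → Point
    toPoint x (yes _)  = (λ _ → 1#) , λ ones≈0 → 1≉0 (ones≈0 i₀)
    toPoint x (no x≉0) = x , x≉0

    toPoint-≈ : ∀ {x} (x? : Dec (∀ i → x i ≈ 0#)) (p : Point) →
                (∀ i → x i ≈ proj₁ p i) → Setoid._≈_ Points (toPoint x x?) p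
    toPoint-≈ (yes x≈0) (_ , p≉0) eq =
      contradiction (λ i → trans (sym (eq i)) (x≈0 i)) p≉0
    toPoint-≈ (no _)    _         eq = ∝-pointwise eq

    decode : Fin (Q ℕ.^ 3) → Vector Carrier 3
    decode n i = E.to (finToFun n i)

  ER : FiniteGraph (c ⊔ ℓ) (c ⊔ ℓ) (c ⊔ ℓ)
  ER = record
    { vertices      = Points
    ; _~_           = _~_
    ; ~-resp-≈      = (λ {u} {v} {w} v≈w u~v → ~-sym {w} {u}
                        (~-respˡ {u} {v} {w} v≈w (~-sym {u} {v} u~v)))
                    , (λ {u} {v} {w} → ~-respˡ {u} {v} {w})
    ; ~-sym         = λ {u} {v} → ~-sym {u} {v}
    ; ~-irrefl      = proj₁
    ; _≈?_          = λ (x , _) (y , _) → x ∝? y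
    ; _~?_          = λ (x , _) (y , _) → ¬? (x ∝? y) ×-dec (dot x y ≈? 0#)
    ; size          = Q ℕ.^ 3
    ; vertex        = λ n → toPoint (decode n) (Fin.all? λ i → decode n i ≈? 0#)
    ; vertex-covers = λ p →
        let n = funToFin (E.from ∘ proj₁ p) in
        n , toPoint-≈ (Fin.all? λ i → decode n i ≈? 0#) p λ i → trans
          (E.to-cong (Fin.finToFun-funToFin {3} {Q} (E.from ∘ proj₁ p) i))
          (E.strictlyInverseˡ (proj₁ p i))
    }

{-# OPTIONS --safe #-}
module Submission where

-- Write |K| = pᴺ.  An isotropic vector (a, b, 1) gives linear coordinates L, M, B on K³
-- in which x · y = 0 becomes L M′ + M L′ + 2 B B′ = 0.  The points with L = 0 need two
-- colours.  For the others normalise L = 1 and put δ = M + B²; adjacency becomes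
-- δ + δ′ = (B - B′)².
--
-- Choose θ ∈ K with 1, θ, …, θᵏ independent over 𝔽ₚ (a counting argument: few elements
-- are roots of polynomials of degree ≤ k), and let W be their span and U that of
-- 1, θ, …, θ²ᵏ, so that squares of elements of W lie in U.  Points with δ ∉ U are
-- properly coloured by the coset of B modulo W and by which of the cosets ± δ + U was
-- chosen to be positive: for equal colours (B - B′)² ∈ U but δ + δ′ ∉ U.  On the points
-- with δ ∈ U the graph has degree at most 2 |U|, as δ′ ∈ U determines B′ up to two
-- choices, so greedy colouring applies.
--
-- Altogether 2 pᴺ⁻ᵏ⁻¹ + 2 p²ᵏ⁺¹ + 3 colours suffice.  With q = pᵉ, the choice
-- k + 1 = ⌈2re/3⌉ gives the bound.

open import Defs
open import Algebra.Bundles using (CommutativeRing)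
import Algebra.Properties.AbelianGroup as AbelianGroupProperties
import Algebra.Properties.CommutativeMonoid.Sum as Sum
import Algebra.Properties.Ring as RingProperties
import Algebra.Properties.Semiring.Mult as Mult
import Algebra.Properties.Semiring.Mult.TCOptimised as TCMult
import Algebra.Solver.Ring as RingSolver
open import Algebra.Solver.Ring.AlmostCommutativeRing using (fromCommutativeRing; _-Raw-AlmostCommutative⟶_)
open import Data.Bool.Base using (Bool; true; false; if_then_else_)
open import Data.Fin.Base as Fin using (Fin; zero; suc; toℕ; combine; remQuot; finToFun; funToFin)
open import Data.Fin.Permutation using (Permutation′; permutation)
import Data.Fin.Properties as Finₚ
open import Data.Integer.Base as ℤ using (ℤ; +_; -[1+_])
import Data.Integer.Properties as ℤₚ
open import Data.List.Base as List using (List; []; _∷_; length; filter; allFin)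
import Data.List.Properties as Listₚ
open import Data.List.Relation.Unary.All as All using (All; []; _∷_)
import Data.List.Relation.Unary.All.Properties as Allₚ
open import Data.List.Relation.Unary.AllPairs as AllPairs using (AllPairs; []; _∷_)
import Data.List.Relation.Unary.AllPairs.Properties as AllPairsₚ
open import Data.List.Relation.Unary.Unique.Propositional using (Unique)
import Data.List.Relation.Unary.Unique.Propositional.Properties as Uniqueₚ
open import Data.Maybe.Base using (Maybe; just; nothing)
open import Data.Nat.Base as ℕ using (ℕ; zero; suc; z≤n; s≤s; NonZero)
open import Data.Nat.Coprimality using (coprime-Bézout; prime⇒coprime)
import Data.Nat.DivMod as ℕ
import Data.Nat.Divisibility as ℕ
open import Data.Nat.GCD using (module Bézout)
open import Data.Nat.Primality using (Prime; prime⇒nonZero; prime⇒nonTrivial)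
import Data.Nat.Properties as ℕₚ
open import Data.Nat.Solver using (module +-*-Solver)
open import Data.Product.Base using (∃; ∃₂; _×_; _,_; proj₁; proj₂; uncurry)
import Data.Rational.Base as ℚ
import Data.Rational.Properties as ℚₚ
import Data.Rational.Unnormalised.Base as ℚᵘ
import Data.Rational.Unnormalised.Properties as ℚᵘₚ
open import Data.Sum.Base using (_⊎_; inj₁; inj₂)
open import Data.Sum.Properties using (inj₁-injective; inj₂-injective)
open import Data.Vec.Functional using (Vector)
open import Function.Base using (_∘_; id)
open import Function.Bundles using (Inverse)
open import Level using (Level; _⊔_)
open import Relation.Binary.Core using (Rel)
open import Relation.Binary.Definitions using (Decidable; Symmetric; tri<; tri≈; tri>)
open import Relation.Binary.PropositionalEquality as ≡ using (_≡_; _≢_)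
import Relation.Binary.Reasoning.Setoid as SetoidReasoning
open import Relation.Binary.Structures using (IsEquivalence)
open import Relation.Nullary using (¬_; Dec; yes; no; does; contradiction)
open import Relation.Nullary.Decidable using (¬?; _×-dec_; map′; decidable-stable; dec-true; dec-false)
open import Relation.Unary as Unary using (Pred)

private variable
  a c ℓ : Level
  X : Set a

-- Finite combinatorics

record Quotient {M} (R : Rel (Fin M) a) : Set a where
  field
    classes         : ℕ
    class           : Fin M → Fin classes
    class-cong      : ∀ {i j} → R i j → class i ≡ class j
    class-injective : ∀ {i j} → class i ≡ class j → R i j
    representative  : ∀ k → ∃ λ i → class i ≡ k

-- Recursion on `M`: element 0 joins the class of a later element related to it, or else opens a
-- class of its own.
quotient : ∀ {M} {R : Rel (Fin M) a} → Decidable R → IsEquivalence R → Quotient R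
quotient {M = zero} R? equiv = record
  { classes         = 0
  ; class           = λ ()
  ; class-cong      = λ { {()} }
  ; class-injective = λ { {()} }
  ; representative  = λ ()
  }
quotient {M = suc M} {R} R? equiv = extend (Finₚ.any? λ j → R? zero (suc j))
  where
  module R = IsEquivalence equiv

  tailQuotient : Quotient (λ i j → R (suc i) (suc j))
  tailQuotient = quotient (λ i j → R? (suc i) (suc j))
    record { refl = R.refl ; sym = R.sym ; trans = R.trans }

  open Quotient tailQuotient

  extend : Dec (∃ λ j → R zero (suc j)) → Quotient R
  extend (yes (j , r)) = record
    { classes         = classes
    ; class           = λ { zero → class j ; (suc i) → class i }
    ; class-cong      = λ
      { {zero}  {zero}  _ → ≡.refl
      ; {zero}  {suc _} s → class-cong (R.trans (R.sym r) s)
      ; {suc _} {zero}  s → class-cong (R.trans s r)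
      ; {suc _} {suc _} s → class-cong s
      }
    ; class-injective = λ
      { {zero}  {zero}  _ → R.refl
      ; {zero}  {suc _} e → R.trans r (class-injective e)
      ; {suc _} {zero}  e → R.trans (class-injective e) (R.sym r)
      ; {suc _} {suc _} e → class-injective e
      }
    ; representative  = λ k → let i , e = representative k in suc i , e
    }
  extend (no ¬r) = record
    { classes         = suc classes
    ; class           = λ { zero → zero ; (suc i) → suc (class i) }
    ; class-cong      = λ
      { {zero}  {zero}  _ → ≡.refl
      ; {zero}  {suc j} s → contradiction (j , s) ¬r
      ; {suc i} {zero}  s → contradiction (i , R.sym s) ¬r
      ; {suc _} {suc _} s → ≡.cong suc (class-cong s)
      }
    ; class-injective = λ
      { {zero}  {zero}  _ → R.refl
      ; {suc _} {suc _} e → class-injective (Finₚ.suc-injective e)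
      }
    ; representative  = λ
      { zero    → zero , ≡.refl
      ; (suc k) → let i , e = representative k in suc i , ≡.cong suc e
      }
    }

module _ {M} {R : Rel (Fin M) a} (Q : Quotient R) where
  open Quotient Q

  -- The class of `member i k` is that of `i`, so the members of the chosen representatives are
  -- pairwise distinct and inject `Fin (classes * s)` into `Fin M`.
  classes*size≤ : ∀ {s} (member : Fin M → Fin s → Fin M) →
    (∀ i k → R i (member i k)) →
    (∀ i {k l} → member i k ≡ member i l → k ≡ l) →
    classes ℕ.* s ℕ.≤ M
  classes*size≤ {s} member related injective = Finₚ.injective⇒≤ {f = f} f-injective
    where
    g : Fin classes × Fin s → Fin M
    g (k , l) = member (proj₁ (representative k)) l

    class-g : ∀ kl → class (g kl) ≡ proj₁ kl
    class-g (k , l) = ≡.trans (≡.sym (class-cong (related _ l))) (proj₂ (representative k))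

    g-injective : ∀ {x y} → g x ≡ g y → x ≡ y
    g-injective {k , _} {k′ , _} e
      with ≡.trans (≡.sym (class-g (k , _))) (≡.trans (≡.cong class e) (class-g (k′ , _)))
    ... | ≡.refl = ≡.cong (k ,_) (injective _ e)

    f : Fin (classes ℕ.* s) → Fin M
    f = g ∘ remQuot s

    f-injective : ∀ {x y} → f x ≡ f y → x ≡ y
    f-injective {x} {y} e = ≡.trans (≡.sym (Finₚ.combine-remQuot {classes} s x))
      (≡.trans (≡.cong (uncurry combine) (g-injective e)) (Finₚ.combine-remQuot {classes} s y))

length-filter-¬ : ∀ {P : Pred X ℓ} (P? : Unary.Decidable P) xs →
  length (filter P? xs) ℕ.+ length (filter (¬? ∘ P?) xs) ≡ length xs
length-filter-¬ P? []       = ≡.refl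
length-filter-¬ P? (x ∷ xs) with does (P? x)
... | true  = ≡.cong suc (length-filter-¬ P? xs)
... | false = ≡.trans (ℕₚ.+-suc _ _) (≡.cong suc (length-filter-¬ P? xs))

-- Induction on the number of values: either the largest value is taken more than `s` times, or
-- discarding the at most `s` elements that take it leaves a list still too long for the other
-- values.
generalizedPigeonhole : ∀ (f : X → ℕ) k s xs → Unique xs → All (λ x → f x ℕ.< k) xs →
  k ℕ.* s ℕ.< length xs →
  ∃₂ λ v ys → Unique ys × All (λ x → f x ≡ v) ys × s ℕ.< length ys
generalizedPigeonhole f zero    s (x ∷ xs) _ (() ∷ _) _
generalizedPigeonhole f (suc k) s xs unique bounded long
  with s ℕₚ.<? length (filter (λ x → f x ℕₚ.≟ k) xs)
... | yes large = k , filter _ xs , Uniqueₚ.filter⁺ _ unique , Allₚ.all-filter _ xs , large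
... | no ¬large = generalizedPigeonhole f k s (filter (¬? ∘ λ x → f x ℕₚ.≟ k) xs)
  (Uniqueₚ.filter⁺ _ unique)
  (All.zipWith (λ (f<1+k , f≢k) → ℕₚ.≤∧≢⇒< (ℕ.s≤s⁻¹ f<1+k) f≢k)
    (Allₚ.filter⁺ _ bounded , Allₚ.all-filter _ xs))
  (ℕₚ.+-cancelˡ-< s _ _ (begin-strict
    s ℕ.+ k ℕ.* s       <⟨ long ⟩
    length xs           ≡⟨ length-filter-¬ (λ x → f x ℕₚ.≟ k) xs ⟨
    length (filter (λ x → f x ℕₚ.≟ k) xs) ℕ.+ length (filter (¬? ∘ λ x → f x ℕₚ.≟ k) xs)
                        ≤⟨ ℕₚ.+-monoˡ-≤ _ (ℕₚ.≮⇒≥ ¬large) ⟩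
    s ℕ.+ length (filter (¬? ∘ λ x → f x ℕₚ.≟ k) xs) ∎))
  where open ℕₚ.≤-Reasoning

-- Cosets of x and -x are told apart by comparing their numbers; both orders give the same answer
-- only if the cosets coincide.
<?-symmetric⇒≡ : ∀ {i j} → does (i ℕₚ.<? j) ≡ does (j ℕₚ.<? i) → i ≡ j
<?-symmetric⇒≡ {i} {j} e with ℕₚ.<-cmp i j
... | tri≈ _ i≡j _   = i≡j
... | tri< i<j _ j≮i = contradiction
  (≡.trans (≡.sym (dec-true (i ℕₚ.<? j) i<j)) (≡.trans e (dec-false (j ℕₚ.<? i) j≮i))) λ ()
... | tri> i≮j _ j<i = contradiction
  (≡.trans (≡.sym (dec-true (j ℕₚ.<? i) j<i)) (≡.trans (≡.sym e) (dec-false (i ℕₚ.<? j) i≮j))) λ ()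

-- If every value were attained, a choice of preimages would inject `Fin (suc D)` into `Fin D`.
missedValue : ∀ {D} (g : Fin D → Fin (suc D)) → ∃ λ v → ∀ k → g k ≢ v
missedValue {D} g with Finₚ.any? (λ v → Finₚ.all? λ k → ¬? (g k Finₚ.≟ v))
... | yes missed = missed
... | no ¬missed = contradiction (Finₚ.injective⇒≤ {f = section} section-injective) ℕₚ.1+n≰n
  where
  preimage : ∀ v → ∃ λ k → g k ≡ v
  preimage v with Finₚ.any? (λ k → g k Finₚ.≟ v)
  ... | yes e = e
  ... | no ¬e = contradiction (v , λ k e → ¬e (k , e)) ¬missed

  section : Fin (suc D) → Fin D
  section = proj₁ ∘ preimage

  section-injective : ∀ {v w} → section v ≡ section w → v ≡ w
  section-injective {v} {w} e = ≡.trans (≡.sym (proj₂ (preimage v)))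
    (≡.trans (≡.cong g e) (proj₂ (preimage w)))

-- Greedy colouring

module _ {M D} {R : Rel (Fin M) a}
  (R-sym : Symmetric R) (R-irrefl : ∀ {i} → ¬ R i i)
  (neighbour : Fin M → Fin D → Fin M)
  (covers : ∀ {i j} → R i j → ∃ λ k → neighbour i k ≡ j)
  where

  private
    -- Vertex `n` is recoloured with a colour absent from its `D` listed neighbours. The list may
    -- contain repetitions and non-neighbours, as long as it covers all neighbours.
    partialColouring : ∀ n → ∃ λ (f : Fin M → Fin (suc D)) →
      ∀ {i j} → toℕ i ℕ.< n → toℕ j ℕ.< n → R i j → f i ≢ f j
    partialColouring zero    = (λ _ → zero) , λ ()
    partialColouring (suc n) with partialColouring n
    ... | f , proper = f′ , proper′
      where
      fresh : ∀ i → ∃ λ v → ∀ k → f (neighbour i k) ≢ v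
      fresh i = missedValue (f ∘ neighbour i)

      f′ : Fin M → Fin (suc D)
      f′ i with toℕ i ℕₚ.≟ n
      ... | yes _ = proj₁ (fresh i)
      ... | no  _ = f i

      avoid : ∀ {i j} → R i j → f j ≢ proj₁ (fresh i)
      avoid {i} r e = let k , e′ = covers r in
        proj₂ (fresh i) k (≡.trans (≡.cong f e′) e)

      proper′ : ∀ {i j} → toℕ i ℕ.< suc n → toℕ j ℕ.< suc n → R i j → f′ i ≢ f′ j
      proper′ {i} {j} i<1+n j<1+n r with toℕ i ℕₚ.≟ n | toℕ j ℕₚ.≟ n
      ... | no i≢n | no j≢n = proper (ℕₚ.≤∧≢⇒< (ℕ.s≤s⁻¹ i<1+n) i≢n)
                                     (ℕₚ.≤∧≢⇒< (ℕ.s≤s⁻¹ j<1+n) j≢n) r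
      ... | yes _  | no _   = avoid r ∘ ≡.sym
      ... | no _   | yes _  = avoid (R-sym r)
      ... | yes e  | yes e′ with Finₚ.toℕ-injective (≡.trans e (≡.sym e′))
      ...   | ≡.refl = contradiction r R-irrefl

  greedyColouring : ∃ λ (f : Fin M → Fin (suc D)) → ∀ {i j} → R i j → f i ≢ f j
  greedyColouring = let f , proper = partialColouring M in
    f , proper (Finₚ.toℕ<n _) (Finₚ.toℕ<n _)

-- Ring identities with integer coefficients

module IntegerCoefficients (R : CommutativeRing c ℓ) where
  open CommutativeRing R
  open RingProperties ring
  open AbelianGroupProperties +-abelianGroup using (⁻¹-∙-comm)
  open TCMult semiring using (×1-homo-*; 1+×; ×-homo-+) renaming (_×_ to _×′_)
  open SetoidReasoning setoid

  -- `_×′_` is the multiple with `1 ×′ x = x` by definition, so the solver constants 0 and 1 are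
  -- literally `0#` and `1#`.
  fromℤ : ℤ → Carrier
  fromℤ (+ n)      = n ×′ 1#
  fromℤ (-[1+ n ]) = - (suc n ×′ 1#)

  private
    cancel-+ : ∀ x y z → (z + x) - (z + y) ≈ x - y
    cancel-+ x y z = begin
      (z + x) - (z + y)       ≈⟨ +-congˡ (⁻¹-∙-comm z y) ⟨
      (z + x) + (- z - y)     ≈⟨ +-congʳ (+-comm z x) ⟩
      (x + z) + (- z - y)     ≈⟨ +-assoc x z _ ⟩
      x + (z + (- z - y))     ≈⟨ +-congˡ (+-assoc z (- z) (- y)) ⟨
      x + ((z - z) - y)       ≈⟨ +-congˡ (+-congʳ (-‿inverseʳ z)) ⟩
      x + (0# - y)            ≈⟨ +-congˡ (+-identityˡ _) ⟩
      x - y                   ∎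

    fromℤ-⊖ : ∀ m n → fromℤ (m ℤ.⊖ n) ≈ m ×′ 1# - n ×′ 1#
    fromℤ-⊖ m       zero    = sym (trans (+-congˡ -0#≈0#) (+-identityʳ _))
    fromℤ-⊖ zero    (suc n) = sym (+-identityˡ _)
    fromℤ-⊖ (suc m) (suc n) = begin
      fromℤ (suc m ℤ.⊖ suc n)               ≡⟨ ≡.cong fromℤ (ℤₚ.[1+m]⊖[1+n]≡m⊖n m n) ⟩
      fromℤ (m ℤ.⊖ n)                       ≈⟨ fromℤ-⊖ m n ⟩
      m ×′ 1# - n ×′ 1#                     ≈⟨ cancel-+ _ _ 1# ⟨
      (1# + m ×′ 1#) - (1# + n ×′ 1#)       ≈⟨ +-cong (1+× m 1#) (-‿cong (1+× n 1#)) ⟨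
      suc m ×′ 1# - suc n ×′ 1#             ∎

    fromℤ-neg : ∀ i → fromℤ (ℤ.- i) ≈ - fromℤ i
    fromℤ-neg (+ zero)    = sym -0#≈0#
    fromℤ-neg (+ (suc n)) = refl
    fromℤ-neg -[1+ n ]    = sym (-‿involutive _)

    fromℤ-+ : ∀ i j → fromℤ (i ℤ.+ j) ≈ fromℤ i + fromℤ j
    fromℤ-+ (+ m)    (+ n)    = ×-homo-+ 1# m n
    fromℤ-+ (+ m)    -[1+ n ] = fromℤ-⊖ m (suc n)
    fromℤ-+ -[1+ m ] (+ n)    = trans (fromℤ-⊖ n (suc m)) (+-comm _ _)
    fromℤ-+ -[1+ m ] -[1+ n ] = begin
      - (suc (suc (m ℕ.+ n)) ×′ 1#)       ≈⟨ -‿cong (reflexive (≡.cong (λ k → suc k ×′ 1#) (ℕₚ.+-suc m n))) ⟨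
      - ((suc m ℕ.+ suc n) ×′ 1#)         ≈⟨ -‿cong (×-homo-+ 1# (suc m) (suc n)) ⟩
      - (suc m ×′ 1# + suc n ×′ 1#)       ≈⟨ ⁻¹-∙-comm _ _ ⟨
      - (suc m ×′ 1#) - (suc n ×′ 1#)     ∎

    fromℤ-*₊ : ∀ m j → fromℤ (+ m ℤ.* j) ≈ fromℤ (+ m) * fromℤ j
    fromℤ-*₊ m (+ n) = trans (reflexive (≡.cong fromℤ (≡.sym (ℤₚ.pos-* m n)))) (×1-homo-* m n)
    fromℤ-*₊ m -[1+ n ] = begin
      fromℤ (+ m ℤ.* -[1+ n ])        ≡⟨ ≡.cong fromℤ (ℤₚ.neg-distribʳ-* (+ m) (+ suc n)) ⟨
      fromℤ (ℤ.- (+ m ℤ.* + suc n))   ≈⟨ fromℤ-neg (+ m ℤ.* + suc n) ⟩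
      - fromℤ (+ m ℤ.* + suc n)       ≈⟨ -‿cong (fromℤ-*₊ m (+ suc n)) ⟩
      - (m ×′ 1# * suc n ×′ 1#)       ≈⟨ -‿distribʳ-* _ _ ⟩
      m ×′ 1# * - (suc n ×′ 1#)       ∎

    fromℤ-* : ∀ i j → fromℤ (i ℤ.* j) ≈ fromℤ i * fromℤ j
    fromℤ-* (+ m)    j = fromℤ-*₊ m j
    fromℤ-* -[1+ m ] j = begin
      fromℤ (-[1+ m ] ℤ.* j)          ≡⟨ ≡.cong fromℤ (ℤₚ.neg-distribˡ-* (+ suc m) j) ⟨
      fromℤ (ℤ.- (+ suc m ℤ.* j))     ≈⟨ fromℤ-neg (+ suc m ℤ.* j) ⟩
      - fromℤ (+ suc m ℤ.* j)         ≈⟨ -‿cong (fromℤ-*₊ (suc m) j) ⟩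
      - (suc m ×′ 1# * fromℤ j)       ≈⟨ -‿distribˡ-* _ _ ⟩
      - (suc m ×′ 1#) * fromℤ j       ∎

    morphism : ℤ.+-*-rawRing -Raw-AlmostCommutative⟶ fromCommutativeRing R
    morphism = record
      { ⟦_⟧    = fromℤ
      ; +-homo = fromℤ-+
      ; *-homo = fromℤ-*
      ; -‿homo = fromℤ-neg
      ; 0-homo = refl
      ; 1-homo = refl
      }

    decide : ∀ i j → Maybe (fromℤ i ≈ fromℤ j)
    decide i j with i ℤₚ.≟ j
    ... | yes i≡j = just (reflexive (≡.cong fromℤ i≡j))
    ... | no  _   = nothing

  open RingSolver ℤ.+-*-rawRing (fromCommutativeRing R) morphism decide public
    using (solve; _:+_; _:*_; _:-_; :-_; con; _:=_)

-- Finite fields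

module FieldProperties {c ℓ Q} (K : FiniteField c ℓ Q) where
  open FiniteField K hiding (zero)
  open RingProperties ring
  open Mult semiring using (×1-homo-*) renaming (_×_ to _⋅_)
  open IntegerCoefficients commutativeRing
  open Sum +-commutativeMonoid using (sum; sum-permute; ∑-distrib-+; sum-replicate; sum-cong-≋)
  open SetoidReasoning setoid
  private module E = Inverse enumeration

  element : Fin Q → Carrier
  element = E.to

  index : Carrier → Fin Q
  index = E.from

  index-cong : ∀ {x y} → x ≈ y → index x ≡ index y
  index-cong = E.from-cong

  element-index : ∀ x → element (index x) ≈ x
  element-index = E.strictlyInverseˡ

  index-element : ∀ i → index (element i) ≡ i
  index-element = E.strictlyInverseʳ

  element-injective : ∀ {i j} → element i ≈ element j → i ≡ j
  element-injective {i} {j} e =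
    ≡.trans (≡.sym (index-element i)) (≡.trans (index-cong e) (index-element j))

  index-injective : ∀ {x y} → index x ≡ index y → x ≈ y
  index-injective {x} {y} e =
    trans (sym (element-index x)) (trans (reflexive (≡.cong element e)) (element-index y))

  cancel : ∀ {x y} → ¬ (x ≈ 0#) → x * y ≈ 0# → y ≈ 0#
  cancel {x} {y} x≉0 xy≈0 = let z , xz≈1 = invertible x x≉0 in begin
    y             ≈⟨ *-identityˡ y ⟨
    1# * y        ≈⟨ *-congʳ xz≈1 ⟨
    (x * z) * y   ≈⟨ solve 3 (λ x y z → (x :* z) :* y := z :* (x :* y)) refl x y z ⟩
    z * (x * y)   ≈⟨ *-congˡ xy≈0 ⟩
    z * 0#        ≈⟨ zeroʳ z ⟩
    0#            ∎

  x-y≈0⇒x≈y : ∀ {x y} → x - y ≈ 0# → x ≈ y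
  x-y≈0⇒x≈y {x} {y} e = begin
    x             ≈⟨ solve 2 (λ x y → x := (x :- y) :+ y) refl x y ⟩
    (x - y) + y   ≈⟨ +-congʳ e ⟩
    0# + y        ≈⟨ +-identityˡ y ⟩
    y             ∎

  x≈y⇒x-y≈0 : ∀ {x y} → x ≈ y → x - y ≈ 0#
  x≈y⇒x-y≈0 {x} {y} e = trans (+-congʳ e) (-‿inverseʳ y)

  squares-≈ : ∀ {x y} → x * x ≈ y * y → x ≈ y ⊎ x + y ≈ 0#
  squares-≈ {x} {y} e with (x - y) ≈? 0#
  ... | yes x-y≈0 = inj₁ (x-y≈0⇒x≈y x-y≈0)
  ... | no  x-y≉0 = inj₂ (cancel x-y≉0 (trans
    (solve 2 (λ x y → (x :- y) :* (x :+ y) := x :* x :- y :* y) refl x y)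
    (x≈y⇒x-y≈0 e)))

  -- Translation by 1 permutes K, so Σ x = Σ (1 + x) = |K| + Σ x.
  order⋅1≈0 : Q ⋅ 1# ≈ 0#
  order⋅1≈0 = x-y≈0⇒x≈y (begin
    Q ⋅ 1# - 0#                   ≈⟨ solve 2 (λ n s → n :- con (+ 0) := (n :+ s) :- s) refl (Q ⋅ 1#) (sum element) ⟩
    (Q ⋅ 1# + sum element) - sum element  ≈⟨ x≈y⇒x-y≈0 shifted ⟩
    0#                            ∎)
    where
    inverses : ∀ {x y} → x + y ≈ 0# → ∀ i → index (x + element (index (y + element i))) ≡ i
    inverses {x} {y} x+y≈0 i = ≡.trans (index-cong (begin
      x + element (index (y + element i))   ≈⟨ +-congˡ (element-index _) ⟩
      x + (y + element i)                   ≈⟨ +-assoc _ _ _ ⟨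
      (x + y) + element i                   ≈⟨ +-congʳ x+y≈0 ⟩
      0# + element i                        ≈⟨ +-identityˡ _ ⟩
      element i                             ∎)) (index-element i)

    π : Permutation′ Q
    π = permutation (λ i → index (1# + element i)) (λ i → index (- 1# + element i))
      (inverses (-‿inverseʳ 1#)) (inverses (-‿inverseˡ 1#))

    shifted : Q ⋅ 1# + sum element ≈ sum element
    shifted = begin
      Q ⋅ 1# + sum element                          ≈⟨ +-congʳ (sum-replicate Q) ⟨
      sum {Q} (λ _ → 1#) + sum element              ≈⟨ ∑-distrib-+ {Q} (λ _ → 1#) element ⟨
      sum (λ i → 1# + element i)                    ≈⟨ sum-cong-≋ {Q} (λ i → element-index (1# + element i)) ⟨
      sum (λ i → element (index (1# + element i)))  ≈⟨ sum-permute element π ⟨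
      sum element                                   ∎

  -- A field has no zero divisors, so a factor of pᴺ · 1 = (p · 1)ᴺ vanishes.
  characteristic : ∀ p N → (p ℕ.^ N) ⋅ 1# ≈ 0# → p ⋅ 1# ≈ 0#
  characteristic p zero    e = contradiction (trans (sym (+-identityʳ 1#)) e) 1≉0
  characteristic p (suc N) e with (p ⋅ 1#) ≈? 0#
  ... | yes p≈0 = p≈0
  ... | no  p≉0 = characteristic p N (cancel p≉0 (trans (sym (×1-homo-* p (p ℕ.^ N))) e))

  -- Polynomials over K, as vectors of coefficients in ascending degree

  eval : ∀ {n} → Vector Carrier n → Carrier → Carrier
  eval {zero}  a x = 0#
  eval {suc n} a x = a zero + x * eval (a ∘ suc) x

  eval-congᵛ : ∀ {n} {a b : Vector Carrier n} x → (∀ i → a i ≈ b i) → eval a x ≈ eval b x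
  eval-congᵛ {zero}  x e = refl
  eval-congᵛ {suc n} x e = +-cong (e zero) (*-congˡ (eval-congᵛ x (e ∘ suc)))

  eval-sub : ∀ {n} (a b : Vector Carrier n) x → eval (λ i → a i - b i) x ≈ eval a x - eval b x
  eval-sub {zero}  a b x = sym (-‿inverseʳ 0#)
  eval-sub {suc n} a b x = trans (+-congˡ (*-congˡ (eval-sub (a ∘ suc) (b ∘ suc) x)))
    (solve 5 (λ a b x s t → (a :- b) :+ x :* (s :- t) := (a :+ x :* s) :- (b :+ x :* t)) refl
      (a zero) (b zero) x _ _)

  -- The coefficients of (a(X) - a(r)) / (X - r), from Horner's scheme.
  quotientBy : ∀ {n} → Carrier → Vector Carrier (suc n) → Vector Carrier n
  quotientBy {suc n} r a zero    = eval (a ∘ suc) r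
  quotientBy {suc n} r a (suc i) = quotientBy r (a ∘ suc) i

  division : ∀ {n} r (a : Vector Carrier (suc n)) x →
    eval a x ≈ eval a r + (x - r) * eval (quotientBy r a) x
  division {zero}  r a x =
    solve 3 (λ a r x → a :+ x :* con (+ 0) := (a :+ r :* con (+ 0)) :+ (x :- r) :* con (+ 0)) refl
      (a zero) r x
  division {suc n} r a x = begin
    a zero + x * eval t x
      ≈⟨ +-congˡ (*-congˡ (division r t x)) ⟩
    a zero + x * (eval t r + (x - r) * eval (quotientBy r t) x)
      ≈⟨ solve 5 (λ a r x u v → a :+ x :* (u :+ (x :- r) :* v) :=
                               (a :+ r :* u) :+ (x :- r) :* (u :+ x :* v)) refl
           (a zero) r x (eval t r) (eval (quotientBy r t) x) ⟩
    (a zero + r * eval t r) + (x - r) * (eval t r + x * eval (quotientBy r t) x) ∎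
    where
    t = a ∘ suc

  -- If a(r) = 0, then `a` is X - r times its quotient. This is kept coefficientwise, since over a
  -- finite field a polynomial can vanish as a function without being zero.
  quotientBy-zero : ∀ {n} r (a : Vector Carrier (suc n)) → eval a r ≈ 0# →
    (∀ i → quotientBy r a i ≈ 0#) → ∀ i → a i ≈ 0#
  quotientBy-zero {n} r a root zeros zero = begin
    a zero                          ≈⟨ +-identityʳ _ ⟨
    a zero + 0#                     ≈⟨ +-congˡ (zeroʳ r) ⟨
    a zero + r * 0#                 ≈⟨ +-congˡ (*-congˡ (tail≈0 n a zeros)) ⟨
    a zero + r * eval (a ∘ suc) r   ≈⟨ root ⟩
    0#                              ∎
    where
    tail≈0 : ∀ n (a : Vector Carrier (suc n)) → (∀ i → quotientBy r a i ≈ 0#) →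
             eval (a ∘ suc) r ≈ 0#
    tail≈0 zero    _ _     = refl
    tail≈0 (suc n) _ zeros = zeros zero
  quotientBy-zero {suc n} r a root zeros (suc i) =
    quotientBy-zero r (a ∘ suc) (zeros zero) (zeros ∘ suc) i

  -- Divide by X - r: every other root x has x - r ≠ 0, so it is a root of the quotient, which has
  -- one coefficient less.
  tooManyRoots⇒zero : ∀ {n} (a : Vector Carrier n) xs →
    AllPairs (λ x y → ¬ (x ≈ y)) xs → All (λ x → eval a x ≈ 0#) xs → n ℕ.≤ length xs →
    ∀ i → a i ≈ 0#
  tooManyRoots⇒zero {suc n} a (r ∷ xs) (r∉xs ∷ distinct) (root ∷ roots) (s≤s n≤) =
    quotientBy-zero r a root (tooManyRoots⇒zero (quotientBy r a) xs distinct
      (All.zipWith (λ (r≉x , x-root) → cancel (r≉x ∘ sym ∘ x-y≈0⇒x≈y) (begin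
          _                                         ≈⟨ +-identityˡ _ ⟨
          0# + _                                    ≈⟨ +-congʳ root ⟨
          eval a r + _                              ≈⟨ division r a _ ⟨
          eval a _                                  ≈⟨ x-root ⟩
          0#                                        ∎))
        (r∉xs , roots)) n≤)

-- Subspaces over the prime field

-- For prime `n` this says that `K` has characteristic `n`.
KilledBy : ∀ {Q} → FiniteField c ℓ Q → ℕ → Set ℓ
KilledBy K n = n ⋅ 1# ≈ 0#
  where
  open FiniteField K using (_≈_; 0#; 1#; semiring)
  open Mult semiring using () renaming (_×_ to _⋅_)

module OddCharacteristic {c ℓ Q} (K : FiniteField c ℓ Q) {p : ℕ} (p-prime : Prime p) (p-odd : Odd p)
  (p⋅1≈0 : KilledBy K p) where
  open FiniteField K hiding (zero)
  open RingProperties ring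
  open Mult semiring using (×1-homo-*; ×-homo-+; ×-homo-1) renaming (_×_ to _⋅_)
  open IntegerCoefficients commutativeRing
  open FieldProperties K
  open SetoidReasoning setoid

  private instance
    p≢0 : NonZero p
    p≢0 = prime⇒nonZero p-prime

  ⌜_⌝ : ℕ → Carrier
  ⌜ n ⌝ = n ⋅ 1#

  multiple≈0 : ∀ k → ⌜ k ℕ.* p ⌝ ≈ 0#
  multiple≈0 k = trans (×1-homo-* k p) (trans (*-congˡ p⋅1≈0) (zeroʳ _))

  ⌜%⌝ : ∀ n → ⌜ n ℕ.% p ⌝ ≈ ⌜ n ⌝
  ⌜%⌝ n = begin
    ⌜ n ℕ.% p ⌝                             ≈⟨ +-identityʳ _ ⟨
    ⌜ n ℕ.% p ⌝ + 0#                        ≈⟨ +-congˡ (multiple≈0 (n ℕ./ p)) ⟨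
    ⌜ n ℕ.% p ⌝ + ⌜ n ℕ./ p ℕ.* p ⌝         ≈⟨ ×-homo-+ 1# (n ℕ.% p) _ ⟨
    ⌜ n ℕ.% p ℕ.+ n ℕ./ p ℕ.* p ⌝           ≡⟨ ≡.cong ⌜_⌝ (ℕ.m≡m%n+[m/n]*n n p) ⟨
    ⌜ n ⌝                                   ∎

  -- `n` is coprime to `p`; with n = p = 0 in `K`, a Bézout identity would read 1 = 0.
  ⌜⌝≉0 : ∀ {n} → 0 ℕ.< n → n ℕ.< p → ¬ (⌜ n ⌝ ≈ 0#)
  ⌜⌝≉0 {n@(suc _)} _ n<p n≈0 with coprime-Bézout (prime⇒coprime p-prime {{_}} n<p)
  ... | Bézout.+- x y eq = 1≉0 (begin
    1#                      ≈⟨ ×-homo-1 1# ⟨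
    ⌜ 1 ⌝                   ≈⟨ +-identityʳ _ ⟨
    ⌜ 1 ⌝ + 0#              ≈⟨ +-congˡ (trans (×1-homo-* y n) (trans (*-congˡ n≈0) (zeroʳ _))) ⟨
    ⌜ 1 ⌝ + ⌜ y ℕ.* n ⌝     ≈⟨ ×-homo-+ 1# 1 (y ℕ.* n) ⟨
    ⌜ 1 ℕ.+ y ℕ.* n ⌝       ≡⟨ ≡.cong ⌜_⌝ eq ⟩
    ⌜ x ℕ.* p ⌝             ≈⟨ multiple≈0 x ⟩
    0#                      ∎)
  ... | Bézout.-+ x y eq = 1≉0 (begin
    1#                      ≈⟨ ×-homo-1 1# ⟨
    ⌜ 1 ⌝                   ≈⟨ +-identityʳ _ ⟨
    ⌜ 1 ⌝ + 0#              ≈⟨ +-congˡ (multiple≈0 x) ⟨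
    ⌜ 1 ⌝ + ⌜ x ℕ.* p ⌝     ≈⟨ ×-homo-+ 1# 1 (x ℕ.* p) ⟨
    ⌜ 1 ℕ.+ x ℕ.* p ⌝       ≡⟨ ≡.cong ⌜_⌝ eq ⟩
    ⌜ y ℕ.* n ⌝             ≈⟨ trans (×1-homo-* y n) (trans (*-congˡ n≈0) (zeroʳ _)) ⟩
    0#                      ∎)

  private
    ⌜⌝-distinct : ∀ {m n} → m ℕ.< n → n ℕ.< p → ¬ (⌜ m ⌝ ≈ ⌜ n ⌝)
    ⌜⌝-distinct {m} {n} m<n n<p e = ⌜⌝≉0 (ℕₚ.m<n⇒0<n∸m m<n)
      (ℕₚ.≤-<-trans (ℕₚ.m∸n≤m n m) n<p)
      (begin
        ⌜ n ℕ.∸ m ⌝                     ≈⟨ solve 2 (λ d m → d := (m :+ d) :- m) refl _ ⌜ m ⌝ ⟩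
        (⌜ m ⌝ + ⌜ n ℕ.∸ m ⌝) - ⌜ m ⌝   ≈⟨ +-congʳ (×-homo-+ 1# m (n ℕ.∸ m)) ⟨
        ⌜ m ℕ.+ (n ℕ.∸ m) ⌝ - ⌜ m ⌝     ≡⟨ ≡.cong (λ k → ⌜ k ⌝ - ⌜ m ⌝) (ℕₚ.m+[n∸m]≡n (ℕₚ.<⇒≤ m<n)) ⟩
        ⌜ n ⌝ - ⌜ m ⌝                   ≈⟨ x≈y⇒x-y≈0 (sym e) ⟩
        0#                              ∎)

  ⌜⌝-injective : ∀ {i j : Fin p} → ⌜ toℕ i ⌝ ≈ ⌜ toℕ j ⌝ → i ≡ j
  ⌜⌝-injective {i} {j} e with ℕₚ.<-cmp (toℕ i) (toℕ j)
  ... | tri< i<j _ _ = contradiction e (⌜⌝-distinct i<j (Finₚ.toℕ<n j))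
  ... | tri≈ _ i≡j _ = Finₚ.toℕ-injective i≡j
  ... | tri> _ _ j<i = contradiction (sym e) (⌜⌝-distinct j<i (Finₚ.toℕ<n i))

  -- As `p` is odd, h = (p + 1) / 2 has 2h = p + 1, which is 1 in `K`. Being a natural number, it
  -- keeps spans over 𝔽ₚ closed under halving.
  half : ∃ λ h → ⌜ h ⌝ + ⌜ h ⌝ ≈ 1#
  half = h , (begin
    ⌜ h ⌝ + ⌜ h ⌝   ≈⟨ ×-homo-+ 1# h h ⟨
    ⌜ h ℕ.+ h ⌝     ≡⟨ ≡.cong ⌜_⌝ h+h≡1+p ⟩
    1# + ⌜ p ⌝      ≈⟨ +-congˡ p⋅1≈0 ⟩
    1# + 0#         ≈⟨ +-identityʳ 1# ⟩
    1#              ∎)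
    where
    h = suc (p ℕ./ 2)

    p%2≡1 : p ℕ.% 2 ≡ 1
    p%2≡1 with p ℕ.% 2 in eq | ℕ.m%n<n p 2
    ... | 0 | _ = contradiction (ℕ.m%n≡0⇒n∣m p 2 eq) p-odd
    ... | 1 | _ = ≡.refl
    ... | suc (suc _) | s≤s (s≤s ())

    h+h≡1+p : h ℕ.+ h ≡ suc p
    h+h≡1+p = ≡.cong suc (≡.trans (ℕₚ.+-suc d d) (≡.sym (≡.trans (ℕ.m≡m%n+[m/n]*n p 2)
      (≡.cong₂ ℕ._+_ p%2≡1 (≡.trans (ℕₚ.*-comm d 2) (≡.cong (d ℕ.+_) (ℕₚ.+-identityʳ d)))))))
      where
      d = p ℕ./ 2

  -- The elements of 𝔽ₚ + 𝔽ₚ θ + ⋯ + 𝔽ₚ θⁿ⁻¹, numbered by the base p digits of their coordinates.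
  combination : ∀ n → Carrier → Fin (p ℕ.^ n) → Carrier
  combination n θ u = eval {n} (λ j → ⌜ toℕ (finToFun u j) ⌝) θ

  -- Linear independence of 1, θ, ..., θⁿ⁻¹ over 𝔽ₚ, in the form that serves for counting.
  Independent : ℕ → Carrier → Set ℓ
  Independent n θ = ∀ {u v} → combination n θ u ≈ combination n θ v → u ≡ v

  -- Existence of θ with 1, θ, ..., θᵏ independent

  module _ (k : ℕ) where
    private
      n = suc k
      P = p ℕ.^ n

      Dependence : Carrier → Fin P → Fin P → Set ℓ
      Dependence θ u v = u ≢ v × combination n θ u ≈ combination n θ v

      dependent? : ∀ θ → Dec (∃₂ (Dependence θ))
      dependent? θ = Finₚ.any? λ u → Finₚ.any? λ v →
        ¬? (u Finₚ.≟ v) ×-dec (combination n θ u ≈? combination n θ v)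

    -- Distinct digit strings differ by a nonzero polynomial of degree at most `k`, which has at
    -- most `k` roots.
    fewDependent : ∀ u v (θs : List (Fin Q)) → AllPairs _≢_ θs →
      All (λ i → combination n (element i) u ≈ combination n (element i) v) θs →
      k ℕ.< length θs → u ≡ v
    fewDependent u v θs unique roots long =
      ≡.trans (≡.sym (Finₚ.funToFin-finToFin {n} {p} u))
        (≡.trans (funToFin-cong n {finToFun u} {finToFun v} λ j → ⌜⌝-injective (x-y≈0⇒x≈y (zeros j)))
          (Finₚ.funToFin-finToFin {n} {p} v))
      where
      funToFin-cong : ∀ n {f g : Fin n → Fin p} → (∀ j → f j ≡ g j) → funToFin f ≡ funToFin g
      funToFin-cong zero    e = ≡.refl
      funToFin-cong (suc n) e = ≡.cong₂ combine (e zero) (funToFin-cong n (e ∘ suc))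

      coefficients : Fin P → Vector Carrier n
      coefficients u j = ⌜ toℕ (finToFun {p} {n} u j) ⌝

      zeros : ∀ j → coefficients u j - coefficients v j ≈ 0#
      zeros = tooManyRoots⇒zero {n} (λ j → coefficients u j - coefficients v j) (List.map element θs)
        (AllPairsₚ.map⁺ (AllPairs.map (λ i≢j → i≢j ∘ element-injective) unique))
        (Allₚ.map⁺ (All.map (λ e → trans (eval-sub {n} (coefficients u) (coefficients v) _) (x≈y⇒x-y≈0 e)) roots))
        (≡.subst (n ℕ.≤_) (≡.sym (Listₚ.length-map element θs)) long)

    -- If every element were dependent, choose a witnessing pair for each. There are P² pairs, so
    -- more than `k` elements share one, contradicting `fewDependent`.
    independentElement : P ℕ.* P ℕ.* k ℕ.< Q → ∃ (Independent n)
    independentElement few with Finₚ.any? (λ i → ¬? (dependent? (element i)))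
    ... | yes (i , independent) = element i , λ {u} {v} e → decidable-stable (u Finₚ.≟ v)
      λ u≢v → independent (u , v , u≢v , e)
    ... | no allDependent = contradiction (fewDependent u v θs unique roots long) u≢v
      where
      dependence : ∀ i → ∃₂ (Dependence (element i))
      dependence i = decidable-stable (dependent? (element i)) λ ¬d → allDependent (i , ¬d)

      code : Fin Q → Fin (P ℕ.* P)
      code i = let u , v , _ = dependence i in combine u v

      large = generalizedPigeonhole (toℕ ∘ code) (P ℕ.* P) k (allFin Q) (Uniqueₚ.allFin⁺ Q)
        (All.universal (λ i → Finₚ.toℕ<n (code i)) _)
        (≡.subst (P ℕ.* P ℕ.* k ℕ.<_) (≡.sym (Listₚ.length-tabulate id)) few)
      θs     = proj₁ (proj₂ large)
      unique = proj₁ (proj₂ (proj₂ large))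
      coded  = proj₁ (proj₂ (proj₂ (proj₂ large)))
      long   = proj₂ (proj₂ (proj₂ (proj₂ large)))

      -- Equal codes mean equal pairs, so the pair of the first element serves the whole list.
      common : ∀ θs → All (λ i → toℕ (code i) ≡ proj₁ large) θs → k ℕ.< length θs →
        ∃₂ λ u v → u ≢ v × All (λ i → combination n (element i) u ≈ combination n (element i) v) θs
      common (i ∷ θs) (e ∷ es) _ = let u , v , u≢v , eᵢ = dependence i in
        u , v , u≢v , eᵢ ∷ All.map (λ {j} eⱼ →
          let u′ , v′ , _ , e′ = dependence j
              u≡ , v≡ = Finₚ.combine-injective u′ v′ u v
                (Finₚ.toℕ-injective (≡.trans eⱼ (≡.sym e)))
          in ≡.subst₂ (λ u v → combination n (element j) u ≈ combination n (element j) v) u≡ v≡ e′) es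

      u     = proj₁ (common θs coded long)
      v     = proj₁ (proj₂ (common θs coded long))
      u≢v   = proj₁ (proj₂ (proj₂ (common θs coded long)))
      roots = proj₂ (proj₂ (proj₂ (common θs coded long)))

  -- Spans of powers of θ and their cosets

  module Spans (θ : Carrier) where

    -- Horner form with unreduced natural coefficients, so that sums and multiples need no reduction
    -- modulo `p`; `nil` at every length saves padding with zeros.
    data Span : ℕ → Carrier → Set (c ⊔ ℓ) where
      nil  : ∀ {n x} → x ≈ 0# → Span n x
      cons : ∀ {n x y} a → Span n y → x ≈ ⌜ a ⌝ + θ * y → Span (suc n) x

    span-resp : ∀ {n x y} → x ≈ y → Span n x → Span n y
    span-resp x≈y (nil e)      = nil (trans (sym x≈y) e)
    span-resp x≈y (cons a s e) = cons a s (trans (sym x≈y) e)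

    span-mono : ∀ {m n x} → m ℕ.≤ n → Span m x → Span n x
    span-mono m≤n       (nil e)      = nil e
    span-mono (s≤s m≤n) (cons a s e) = cons a (span-mono m≤n s) e

    span-+ : ∀ {n x y} → Span n x → Span n y → Span n (x + y)
    span-+ (nil e) t = span-resp (sym (trans (+-congʳ e) (+-identityˡ _))) t
    span-+ s (nil e) = span-resp (sym (trans (+-congˡ e) (+-identityʳ _))) s
    span-+ (cons a s e) (cons b t f) = cons (a ℕ.+ b) (span-+ s t) (begin
      _                                       ≈⟨ +-cong e f ⟩
      (⌜ a ⌝ + θ * _) + (⌜ b ⌝ + θ * _)       ≈⟨ solve 5 (λ a b θ x y →
        (a :+ θ :* x) :+ (b :+ θ :* y) := (a :+ b) :+ θ :* (x :+ y)) refl _ _ θ _ _ ⟩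
      (⌜ a ⌝ + ⌜ b ⌝) + θ * _                 ≈⟨ +-congʳ (×-homo-+ 1# a b) ⟨
      ⌜ a ℕ.+ b ⌝ + θ * _                     ∎)

    span-scale : ∀ {n x} k → Span n x → Span n (⌜ k ⌝ * x)
    span-scale k (nil e) = nil (trans (*-congˡ e) (zeroʳ _))
    span-scale k (cons {y = y} a s e) = cons (k ℕ.* a) (span-scale k s) (begin
      ⌜ k ⌝ * _                           ≈⟨ *-congˡ e ⟩
      ⌜ k ⌝ * (⌜ a ⌝ + θ * y)             ≈⟨ solve 4 (λ k a θ y →
        k :* (a :+ θ :* y) := k :* a :+ θ :* (k :* y)) refl _ _ θ y ⟩
      ⌜ k ⌝ * ⌜ a ⌝ + θ * (⌜ k ⌝ * y)     ≈⟨ +-congʳ (×1-homo-* k a) ⟨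
      ⌜ k ℕ.* a ⌝ + θ * (⌜ k ⌝ * y)       ∎)

    -- In characteristic `p` the natural number p - 1 acts as -1.
    span-neg : ∀ {n x} → Span n x → Span n (- x)
    span-neg {x = x} s = span-resp (begin
      ⌜ ℕ.pred p ⌝ * x                ≈⟨ solve 2 (λ k x → k :* x := (con (+ 1) :+ k) :* x :- x) refl _ x ⟩
      (1# + ⌜ ℕ.pred p ⌝) * x - x     ≡⟨ ≡.cong (λ k → ⌜ k ⌝ * x - x) (ℕₚ.suc-pred p) ⟩
      ⌜ p ⌝ * x - x                   ≈⟨ +-congʳ (trans (*-congʳ p⋅1≈0) (zeroˡ x)) ⟩
      0# - x                          ≈⟨ +-identityˡ _ ⟩
      - x                             ∎) (span-scale (ℕ.pred p) s)

    span-half : ∀ {n x} → Span n (x + x) → Span n x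
    span-half {x = x} s = let h , h+h≈1 = half in span-resp (begin
      ⌜ h ⌝ * (x + x)       ≈⟨ solve 2 (λ h x → h :* (x :+ x) := (h :+ h) :* x) refl _ x ⟩
      (⌜ h ⌝ + ⌜ h ⌝) * x   ≈⟨ *-congʳ h+h≈1 ⟩
      1# * x                ≈⟨ *-identityˡ x ⟩
      x                     ∎) (span-scale h s)

    -- Degrees in θ add: induct on the first factor with (a + θ x′) y = a y + θ (x′ y). For m = n =
    -- k this puts squares of elements of W in U.
    span-* : ∀ {m n x y} → Span (suc m) x → Span (suc n) y → Span (suc (m ℕ.+ n)) (x * y)
    span-* (nil e) t = nil (trans (*-congʳ e) (zeroˡ _))
    span-* {m} {n} {x} {y} (cons {y = x′} a s e) t = span-resp (begin
      ⌜ a ⌝ * y + θ * (x′ * y)    ≈⟨ solve 4 (λ a θ x y →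
        a :* y :+ θ :* (x :* y) := (a :+ θ :* x) :* y) refl _ θ x′ y ⟩
      (⌜ a ⌝ + θ * x′) * y        ≈⟨ *-congʳ e ⟨
      x * y                       ∎)
      (span-+ (span-mono (s≤s (ℕₚ.m≤n+m n m)) (span-scale a t))
              (cons 0 (product m s) (sym (+-identityˡ _))))
      where
      product : ∀ m {x} → Span m x → Span (m ℕ.+ n) (x * y)
      product _       (nil e)        = nil (trans (*-congʳ e) (zeroˡ _))
      product (suc m) s@(cons _ _ _) = span-* s t

    combination⇒span : ∀ n u → Span n (combination n θ u)
    combination⇒span n u = go {n} (finToFun u)
      where
      go : ∀ {n} (v : Fin n → Fin p) → Span n (eval (λ j → ⌜ toℕ (v j) ⌝) θ)
      go {zero}  v = nil refl
      go {suc n} v = cons (toℕ (v zero)) (go (v ∘ suc)) refl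

    -- Coefficients are reduced modulo `p` and padded with zero digits, which makes membership a
    -- finite search.
    span⇒combination : ∀ {n x} → Span n x → ∃ λ u → combination n θ u ≈ x
    span⇒combination {n} s = let v , e = digits s in
      funToFin v , trans (eval-congᵛ θ λ j →
        reflexive (≡.cong (λ i → ⌜ toℕ i ⌝) (Finₚ.finToFun-funToFin v j))) e
      where
      digit : ℕ → Fin p
      digit a = a ℕ.mod p

      digit-≈ : ∀ a → ⌜ toℕ (digit a) ⌝ ≈ ⌜ a ⌝
      digit-≈ a = trans (reflexive (≡.cong ⌜_⌝ (Finₚ.toℕ-fromℕ< (ℕ.m%n<n a p)))) (⌜%⌝ a)

      digits : ∀ {n x} → Span n x → ∃ λ (v : Fin n → Fin p) → eval (λ j → ⌜ toℕ (v j) ⌝) θ ≈ x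
      digits {zero}  (nil e) = (λ ()) , sym e
      digits {suc n} (nil e) = let v , f = digits {n} (nil refl) in
        (λ { zero → digit 0 ; (suc j) → v j }) ,
        trans (+-cong (digit-≈ 0) (trans (*-congˡ f) (zeroʳ θ))) (trans (+-identityʳ 0#) (sym e))
      digits (cons a s e) = let v , f = digits s in
        (λ { zero → digit a ; (suc j) → v j }) ,
        trans (+-cong (digit-≈ a) (*-congˡ f)) (sym e)

    span₀⇒≈0 : ∀ {x} → Span 0 x → x ≈ 0#
    span₀⇒≈0 (nil e) = e

    abstract
      span? : ∀ n x → Dec (Span n x)
      span? n x = map′
        (λ (u , e) → span-resp e (combination⇒span n u))
        span⇒combination
        (Finₚ.any? λ u → combination n θ u ≈? x)

      cosets : ∀ n → Quotient (λ i j → Span n (element i - element j))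
      cosets n = quotient (λ i j → span? n _) record
        { refl  = nil (-‿inverseʳ _)
        ; sym   = λ s → span-resp (solve 2 (λ x y → :- (x :- y) := y :- x) refl _ _) (span-neg s)
        ; trans = λ s t → span-resp
            (solve 3 (λ x y z → (x :- y) :+ (y :- z) := x :- z) refl _ _ _) (span-+ s t)
        }

      coset : ∀ n → Carrier → Fin (Quotient.classes (cosets n))
      coset n x = Quotient.class (cosets n) (index x)

      coset-cong : ∀ n {x y} → Span n (x - y) → coset n x ≡ coset n y
      coset-cong n s = Quotient.class-cong (cosets n)
        (span-resp (sym (+-cong (element-index _) (-‿cong (element-index _)))) s)

      coset-injective : ∀ n {x y} → coset n x ≡ coset n y → Span n (x - y)
      coset-injective n e = span-resp (+-cong (element-index _) (-‿cong (element-index _)))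
        (Quotient.class-injective (cosets n) e)

      -- By independence, adding the combinations to an element gives pⁿ distinct elements of its
      -- coset.
      cosets*size≤ : ∀ n → Independent n θ →
        Quotient.classes (cosets n) ℕ.* p ℕ.^ n ℕ.≤ Q
      cosets*size≤ n independent = classes*size≤ (cosets n)
        (λ i u → index (element i + combination n θ u))
        (λ i u → span-resp (begin
          - combination n θ u
            ≈⟨ solve 2 (λ x y → :- y := x :- (x :+ y)) refl (element i) _ ⟩
          element i - (element i + combination n θ u)
            ≈⟨ +-congˡ (-‿cong (element-index _)) ⟨
          element i - element (index (element i + combination n θ u)) ∎)
          (span-neg (combination⇒span n u)))
        (λ i e → independent (+-cancelˡ _ _ _ (index-injective e)))

      -- A choice of one half out of each pair of cosets ± x + Span n.
      sign : ℕ → Carrier → Bool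
      sign n x = does (toℕ (coset n x) ℕₚ.<? toℕ (coset n (- x)))

      -- Here x and -x lie in one coset, where the strict comparison fails.
      span⇒sign≡false : ∀ n {x} → Span n x → sign n x ≡ false
      span⇒sign≡false n {x} s = dec-false (_ ℕₚ.<? _) (ℕₚ.<-irrefl (≡.cong toℕ (coset-cong n
        (span-resp (sym (+-congˡ (-‿involutive x))) (span-+ s s)))))

      -- If x + y is in the span, then y lies in the coset of -x and -y in that of x, so the sign of
      -- y compares the same two cosets in reverse order. Equal signs make them coincide, so 2x and
      -- hence x lies in the span.
      sign-separates : ∀ n {x y} → sign n x ≡ sign n y → Span n (x + y) → Span n x
      sign-separates n {x} {y} e s = span-half (span-resp (+-congˡ (-‿involutive x))
        (coset-injective n (Finₚ.toℕ-injective (<?-symmetric⇒≡ (≡.trans e (≡.cong₂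
          (λ i j → does (toℕ i ℕₚ.<? toℕ j))
          (coset-cong n (span-resp (trans (+-comm x y) (+-congˡ (sym (-‿involutive x)))) s))
          (≡.sym (coset-cong n (span-resp (+-congˡ (sym (-‿involutive y))) s)))))))))

-- Colourings of the polarity graph

join-injective : ∀ {m n} {x y : Fin m ⊎ Fin n} → Fin.join m n x ≡ Fin.join m n y → x ≡ y
join-injective {m} {n} {x} {y} e = ≡.trans (≡.sym (Finₚ.splitAt-join m n x))
  (≡.trans (≡.cong (Fin.splitAt m) e) (Finₚ.splitAt-join m n y))

module Colouring {c ℓ Q} (K : FiniteField c ℓ Q) {p : ℕ} (p-prime : Prime p) (p-odd : Odd p)
  (p⋅1≈0 : KilledBy K p) where
  open FiniteField K hiding (zero)
  open RingProperties ring
  open IntegerCoefficients commutativeRing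
  open FieldProperties K
  open OddCharacteristic K p-prime p-odd p⋅1≈0
  open SetoidReasoning setoid

  x+x≈0⇒x≈0 : ∀ {x} → x + x ≈ 0# → x ≈ 0#
  -- `Span 0` is {0} whatever θ is, so halving within it cancels the factor 2.
  x+x≈0⇒x≈0 e = Spans.span₀⇒≈0 0# (Spans.span-half 0# (Spans.nil e))

  square≈0⇒≈0 : ∀ {x} → x * x ≈ 0# → x ≈ 0#
  square≈0⇒≈0 {x} e with x ≈? 0#
  ... | yes x≈0 = x≈0
  ... | no  x≉0 = cancel x≉0 e

  -- With one of x, -x chosen for every x, the values x² for the chosen half,
  -- -1 - x² for the other half, and -1 cannot all be distinct.
  minusOneSumOfSquares : ∃₂ λ a b → (a * a + b * b) + 1# ≈ 0#
  minusOneSumOfSquares = let i , j , i<j , e = Finₚ.pigeonhole (ℕₚ.n<1+n Q) (index ∘ value) in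
    collide i j i<j (index-injective e)
    where
    open Spans 0#

    pick : Bool → Carrier → Carrier
    pick false x = x * x
    pick true  x = - 1# - x * x

    value : Fin (suc Q) → Carrier
    -- As `Span 0` is {0}, `sign 0` picks one of x, -x, and 0 gets `false`. So -1 = -1 - 0² is not
    -- among the `true` values and is added separately, for Q + 1 values in all.
    value zero    = - 1#
    value (suc i) = pick (sign 0 (element i)) (element i)

    solution : ∀ x y → x * x ≈ - 1# - y * y → ∃₂ λ a b → (a * a + b * b) + 1# ≈ 0#
    solution x y e = x , y , (begin
      (x * x + y * y) + 1#              ≈⟨ +-congʳ (+-congʳ e) ⟩
      ((- 1# - y * y) + y * y) + 1#     ≈⟨ solve 1 (λ y →
        ((:- con (+ 1) :- y :* y) :+ y :* y) :+ con (+ 1) := con (+ 0)) refl y ⟩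
      0#                                ∎)

    cancel-1 : ∀ {x y} → - 1# - x ≈ - 1# - y → x ≈ y
    cancel-1 {x} {y} e = begin
      x                     ≈⟨ solve 1 (λ x → x := :- con (+ 1) :- (:- con (+ 1) :- x)) refl x ⟩
      - 1# - (- 1# - x)     ≈⟨ +-congˡ (-‿cong e) ⟩
      - 1# - (- 1# - y)     ≈⟨ solve 1 (λ y → :- con (+ 1) :- (:- con (+ 1) :- y) := y) refl y ⟩
      y                     ∎

    -- x² = y² forces y = x or y = -x; in the latter case equal signs make both 0.
    sameHalf : ∀ {i j} → i Fin.< j → sign 0 (element i) ≡ sign 0 (element j) →
               ¬ (element i * element i ≈ element j * element j)
    sameHalf {i} {j} i<j same e with squares-≈ e
    ... | inj₁ x≈y = Finₚ.<-irrefl (element-injective x≈y) i<j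
    ... | inj₂ x+y≈0 = Finₚ.<-irrefl (element-injective (trans x≈0 (begin
      0#                      ≈⟨ x+y≈0 ⟨
      element i + element j   ≈⟨ +-congʳ x≈0 ⟩
      0# + element j          ≈⟨ +-identityˡ _ ⟩
      element j               ∎))) i<j
      where
      x≈0 : element i ≈ 0#
      x≈0 = span₀⇒≈0 (sign-separates 0 same (nil x+y≈0))

    collide : ∀ i j → i Fin.< j → value i ≈ value j → ∃₂ λ a b → (a * a + b * b) + 1# ≈ 0#
    collide zero (suc j) _ e with sign 0 (element j) in s
    ... | false = solution (element j) 0# (trans (sym e)
      (solve 0 (:- con (+ 1) := :- con (+ 1) :- con (+ 0) :* con (+ 0)) refl))
    -- -1 = -1 - y² gives y = 0, whose sign is `false`.
    ... | true  = contradiction (≡.trans (≡.sym s) (span⇒sign≡false 0 (nil (square≈0⇒≈0 (sym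
      (cancel-1 (trans (solve 0 (:- con (+ 1) :- con (+ 0) := :- con (+ 1)) refl) e))))))) λ ()
    collide (suc i) (suc j) (s≤s i<j) e
      with sign 0 (element i) in s | sign 0 (element j) in t
    ... | false | true  = solution (element i) (element j) e
    ... | true  | false = solution (element j) (element i) (sym e)
    ... | false | false = contradiction e (sameHalf i<j (≡.trans s (≡.sym t)))
    ... | true  | true  = contradiction (cancel-1 e) (sameHalf i<j (≡.trans s (≡.sym t)))

  -- The default 0 at non-squares is harmless: roots are needed at sums δ + δ′ of neighbours, which
  -- adjacency makes squares.
  squareRoot : Carrier → Carrier
  squareRoot x with Finₚ.any? (λ i → (element i * element i) ≈? x)
  ... | yes (i , _) = element i
  ... | no _        = 0#

  squareRoot-square : ∀ {x} y → y * y ≈ x → squareRoot x * squareRoot x ≈ x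
  squareRoot-square {x} y e with Finₚ.any? (λ i → (element i * element i) ≈? x)
  ... | yes (_ , e′) = e′
  ... | no  ¬root    = contradiction
    (index y , trans (*-cong (element-index y) (element-index y)) e) ¬root

  -- Colouring the pairs (B, δ)

  module _ (k : ℕ) {θ} (independent : Independent (suc k) θ) where
    open Spans θ

    private
      -- Squares of elements of Span w lie in Span u.
      w u : ℕ
      w = suc k
      u = suc (k ℕ.+ k)

      cosetsʷ : ℕ
      cosetsʷ = Quotient.classes (cosets w)

      degree : ℕ
      degree = 2 ℕ.* p ℕ.^ u

    planeColours : ℕ
    planeColours = cosetsʷ ℕ.* 2 ℕ.+ suc degree

    private
      Pair : Set
      Pair = Fin (Q ℕ.* Q)

      β δ : Pair → Carrier
      β = element ∘ proj₁ ∘ remQuot {Q} Q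
      δ = element ∘ proj₂ ∘ remQuot {Q} Q

      pair : Carrier → Carrier → Pair
      pair x y = combine (index x) (index y)

      pair-≡ : ∀ {x y} j → x ≈ β j → y ≈ δ j → pair x y ≡ j
      pair-≡ j x≈β y≈δ = ≡.trans (≡.cong₂ combine
        (≡.trans (index-cong x≈β) (index-element _))
        (≡.trans (index-cong y≈δ) (index-element _))) (Finₚ.combine-remQuot {Q} Q j)

      β-pair : ∀ x y → β (pair x y) ≈ x
      β-pair x y = trans (reflexive (≡.cong (element ∘ proj₁)
        (Finₚ.remQuot-combine (index x) (index y)))) (element-index x)

      δ-pair : ∀ x y → δ (pair x y) ≈ y
      δ-pair x y = trans (reflexive (≡.cong (element ∘ proj₂)
        (Finₚ.remQuot-combine (index x) (index y)))) (element-index y)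

      _Adjacent_ : Pair → Pair → Set ℓ
      i Adjacent j = δ i + δ j ≈ (β i - β j) * (β i - β j)

      -- `i ≢ j` removes the loops of `_Adjacent_`, which occur where δ = 0, at the points
      -- orthogonal to themselves.
      Conflict : Pair → Pair → Set (c ⊔ ℓ)
      Conflict i j = i ≢ j × Span u (δ i) × Span u (δ j) × i Adjacent j

      conflict-sym : ∀ {i j} → Conflict i j → Conflict j i
      conflict-sym {i} {j} (i≢j , s , t , e) = i≢j ∘ ≡.sym , t , s , (begin
        δ j + δ i                     ≈⟨ +-comm _ _ ⟩
        δ i + δ j                     ≈⟨ e ⟩
        (β i - β j) * (β i - β j)     ≈⟨ solve 2 (λ x y → (x :- y) :* (x :- y) := (y :- x) :* (y :- x)) refl (β i) (β j) ⟩
        (β j - β i) * (β j - β i)     ∎)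

      -- For each δ′ in U, the two solutions B′ = B ∓ √(δ + δ′) of the adjacency equation; the
      -- values are spurious if δ + δ′ is not a square.
      candidate : Pair → Fin 2 × Fin (p ℕ.^ u) → Pair
      candidate i (zero , v) =
        pair (β i - squareRoot (δ i + combination u θ v)) (combination u θ v)
      candidate i (suc _ , v) =
        pair (β i + squareRoot (δ i + combination u θ v)) (combination u θ v)

      candidate-covers : ∀ {i j} → Conflict i j → ∃ λ sv → candidate i sv ≡ j
      candidate-covers {i} {j} (_ , _ , t , e) = cover (squares-≈ root²)
        where
        v  = proj₁ (span⇒combination t)
        v≈ = proj₂ (span⇒combination t)
        r  = squareRoot (δ i + combination u θ v)

        difference² : (β i - β j) * (β i - β j) ≈ δ i + combination u θ v
        difference² = trans (sym e) (+-congˡ (sym v≈))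

        root² : r * r ≈ (β i - β j) * (β i - β j)
        root² = trans (squareRoot-square _ difference²) (sym difference²)

        cover : r ≈ β i - β j ⊎ r + (β i - β j) ≈ 0# → ∃ λ sv → candidate i sv ≡ j
        cover (inj₁ r≈) = (zero , v) , pair-≡ j (begin
          β i - r               ≈⟨ +-congˡ (-‿cong r≈) ⟩
          β i - (β i - β j)     ≈⟨ solve 2 (λ x y → x :- (x :- y) := y) refl (β i) (β j) ⟩
          β j                   ∎) v≈
        cover (inj₂ r≈) = (suc zero , v) , pair-≡ j (begin
          β i + r                       ≈⟨ solve 3 (λ x y r → x :+ r := y :+ (r :+ (x :- y))) refl (β i) (β j) r ⟩
          β j + (r + (β i - β j))       ≈⟨ +-congˡ r≈ ⟩
          β j + 0#                      ≈⟨ +-identityʳ _ ⟩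
          β j                           ∎) v≈

      abstract
        greedy : ∃ λ (f : Pair → Fin (suc degree)) → ∀ {i j} → Conflict i j → f i ≢ f j
        greedy = greedyColouring {R = Conflict} (λ {i} {j} → conflict-sym {i} {j})
          (λ (i≢i , _) → i≢i ≡.refl)
          (λ i → candidate i ∘ remQuot (p ℕ.^ u))
          λ {i} {j} conflict → let (s , v) , e = candidate-covers {i} {j} conflict in
            combine s v , ≡.trans (≡.cong (candidate i) (Finₚ.remQuot-combine s v)) e

      bit : Bool → Fin 2
      bit b = if b then zero else suc zero

      bit-injective : ∀ {a b} → bit a ≡ bit b → a ≡ b
      bit-injective {false} {false} _ = ≡.refl
      bit-injective {true}  {true}  _ = ≡.refl

      part : ∀ i → Dec (Span u (δ i)) → Fin (cosetsʷ ℕ.* 2) ⊎ Fin (suc degree)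
      part i (yes _) = inj₂ (proj₁ greedy i)
      part i (no _)  = inj₁ (combine (coset w (β i)) (bit (sign u (δ i))))

      -- The conclusion is an equality because `_Adjacent_` has loops. Outside U, equal cosets of W
      -- put (β i - β j)² and hence δ i + δ j in U, and equal signs then put δ i in U. Inside U the
      -- greedy colouring separates distinct pairs.
      part-proper : ∀ i j s t → i Adjacent j → part i s ≡ part j t → i ≡ j
      part-proper i j (yes s) (yes t) adj e = decidable-stable (i Finₚ.≟ j) λ i≢j →
        proj₂ greedy {i} {j} (i≢j , s , t , adj) (inj₂-injective e)
      part-proper i j (no ¬s) (no _) adj e = contradiction
        (sign-separates u (bit-injective sameSign)
          (span-resp (sym adj) (span-* difference difference))) ¬s
        where
        both = Finₚ.combine-injective (coset w (β i)) _ (coset w (β j)) _ (inj₁-injective e)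
        sameSign = proj₂ both

        difference : Span w (β i - β j)
        difference = coset-injective w (proj₁ both)

      pairColour : Pair → Fin planeColours
      pairColour i = Fin.join _ _ (part i (span? u (δ i)))

    abstract
      planeColour : Carrier → Carrier → Fin planeColours
      planeColour x y = pairColour (pair x y)

      planeColour-cong : ∀ {x x′ y y′} → x ≈ x′ → y ≈ y′ → planeColour x y ≡ planeColour x′ y′
      planeColour-cong e f = ≡.cong₂ (λ i j → pairColour (combine i j)) (index-cong e) (index-cong f)

      planeColour-proper : ∀ {x y x′ y′} → y + y′ ≈ (x - x′) * (x - x′) →
        planeColour x y ≡ planeColour x′ y′ → x ≈ x′ × y ≈ y′
      planeColour-proper {x} {y} {x′} {y′} adj e =
        let i , j = Finₚ.combine-injective (index x) (index y) (index x′) (index y′)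
              (part-proper (pair x y) (pair x′ y′) (span? u _) (span? u _) (begin
                δ (pair x y) + δ (pair x′ y′)   ≈⟨ +-cong (δ-pair x y) (δ-pair x′ y′) ⟩
                y + y′                          ≈⟨ adj ⟩
                (x - x′) * (x - x′)             ≈⟨ *-cong β-difference β-difference ⟨
                _                               ∎) (join-injective e))
        in index-injective i , index-injective j
        where
        β-difference : β (pair x y) - β (pair x′ y′) ≈ x - x′
        β-difference = +-cong (β-pair x y) (-‿cong (β-pair x′ y′))

  -- Coordinates in which the form is -(L M′ + M L′ + 2 B B′)/2.
  module Coordinates {a b : Carrier} (a²+b²+1≈0 : (a * a + b * b) + 1# ≈ 0#) where

    -- Dot products with (a, b, 1), (a, b, -1) and (b, -a, 0): two isotropic vectors and a vector
    -- orthogonal to both.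
    L M B : Vector Carrier 3 → Carrier
    L x = (a * x zero + b * x (suc zero)) + x (suc (suc zero))
    M x = (a * x zero + b * x (suc zero)) - x (suc (suc zero))
    B x = b * x zero - a * x (suc zero)

    scaled : ∀ {x y s} → (∀ i → x i ≈ s * y i) → L x ≈ s * L y × M x ≈ s * M y × B x ≈ s * B y
    scaled {x} {y} {s} e =
      trans (+-cong (+-cong (*-congˡ (e zero)) (*-congˡ (e (suc zero)))) (e (suc (suc zero))))
        (solve 6 (λ a b s x y z → (a :* (s :* x) :+ b :* (s :* y)) :+ s :* z :=
          s :* ((a :* x :+ b :* y) :+ z)) refl a b s _ _ _) ,
      trans (+-cong (+-cong (*-congˡ (e zero)) (*-congˡ (e (suc zero)))) (-‿cong (e (suc (suc zero)))))
        (solve 6 (λ a b s x y z → (a :* (s :* x) :+ b :* (s :* y)) :- s :* z :=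
          s :* ((a :* x :+ b :* y) :- z)) refl a b s _ _ _) ,
      trans (+-cong (*-congˡ (e zero)) (-‿cong (*-congˡ (e (suc zero)))))
        (solve 5 (λ a b s x y → b :* (s :* x) :- a :* (s :* y) :=
          s :* (b :* x :- a :* y)) refl a b s _ _)

    private
      -- The solver does not know a² + b² + 1 = 0; its identities carry an explicit multiple of the
      -- left side, which is dropped here.
      remove-relation : ∀ {x y} → x + ((a * a + b * b) + 1#) * y ≈ x
      remove-relation =
        trans (+-congˡ (trans (*-congʳ a²+b²+1≈0) (zeroˡ _))) (+-identityʳ _)

      -- The inverse change of coordinates, times 2 to avoid division.
      doubled : Carrier → Carrier → Carrier → Vector Carrier 3
      doubled l m β zero             = - (a * (l + m) + (b * β + b * β))
      doubled l m β (suc zero)       = - (b * (l + m) - (a * β + a * β))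
      doubled l m β (suc (suc zero)) = l - m

      double : ∀ x i → x i + x i ≈ doubled (L x) (M x) (B x) i
      double x zero = trans (solve 5 (λ a b x y z →
        let L = (a :* x :+ b :* y) :+ z
            M = (a :* x :+ b :* y) :- z
            B = b :* x :- a :* y
        in x :+ x := :- (a :* (L :+ M) :+ (b :* B :+ b :* B))
             :+ ((a :* a :+ b :* b) :+ con (+ 1)) :* (x :+ x)) refl a b _ _ _)
        (remove-relation)
      double x (suc zero) = trans (solve 5 (λ a b x y z →
        let L = (a :* x :+ b :* y) :+ z
            M = (a :* x :+ b :* y) :- z
            B = b :* x :- a :* y
        in y :+ y := :- (b :* (L :+ M) :- (a :* B :+ a :* B))
             :+ ((a :* a :+ b :* b) :+ con (+ 1)) :* (y :+ y)) refl a b _ _ _)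
        (remove-relation)
      double x (suc (suc zero)) = solve 5 (λ a b x y z →
        z :+ z := ((a :* x :+ b :* y) :+ z) :- ((a :* x :+ b :* y) :- z)) refl a b _ _ _

      doubled-cong : ∀ {l l′ m m′ β β′} → l ≈ l′ → m ≈ m′ → β ≈ β′ →
                     ∀ i → doubled l m β i ≈ doubled l′ m′ β′ i
      doubled-cong e f g zero = -‿cong (+-cong (*-congˡ (+-cong e f)) (+-cong (*-congˡ g) (*-congˡ g)))
      doubled-cong e f g (suc zero) =
        -‿cong (+-cong (*-congˡ (+-cong e f)) (-‿cong (+-cong (*-congˡ g) (*-congˡ g))))
      doubled-cong e f g (suc (suc zero)) = +-cong e (-‿cong f)

    coordinates-injective : ∀ {x y} → L x ≈ L y → M x ≈ M y → B x ≈ B y → ∀ i → x i ≈ y i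
    coordinates-injective {x} {y} l m β i = x-y≈0⇒x≈y (x+x≈0⇒x≈0 (begin
      (x i - y i) + (x i - y i)
        ≈⟨ solve 2 (λ x y → (x :- y) :+ (x :- y) := (x :+ x) :- (y :+ y)) refl _ _ ⟩
      (x i + x i) - (y i + y i)
        ≈⟨ x≈y⇒x-y≈0 (trans (double x i) (trans (doubled-cong l m β i) (sym (double y i)))) ⟩
      0# ∎))

    orthogonal : ∀ x y → dot K x y ≈ 0# →
      (B x * B y + B x * B y) + (L x * M y + M x * L y) ≈ 0#
    orthogonal x y e = begin
      (B x * B y + B x * B y) + (L x * M y + M x * L y)
        ≈⟨ solve 8 (λ a b x₀ x₁ x₂ y₀ y₁ y₂ →
             let d = x₀ :* y₀ :+ x₁ :* y₁ :+ x₂ :* y₂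
                 e = x₀ :* y₀ :+ x₁ :* y₁
                 L = a :* x₀ :+ b :* x₁ :+ x₂ ; L′ = a :* y₀ :+ b :* y₁ :+ y₂
                 M = a :* x₀ :+ b :* x₁ :- x₂ ; M′ = a :* y₀ :+ b :* y₁ :- y₂
                 B = b :* x₀ :- a :* x₁       ; B′ = b :* y₀ :- a :* y₁
             in (B :* B′ :+ B :* B′) :+ (L :* M′ :+ M :* L′) :=
                :- (d :+ d) :+ (a :* a :+ b :* b :+ con (+ 1)) :* (e :+ e)) refl
             a b (x zero) (x (suc zero)) (x (suc (suc zero))) (y zero) (y (suc zero)) (y (suc (suc zero))) ⟩
      - (dot K x y + dot K x y) + ((a * a + b * b) + 1#) * _
        ≈⟨ remove-relation ⟩
      - (dot K x y + dot K x y)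
        ≈⟨ -‿cong (+-cong e e) ⟩
      - (0# + 0#)
        ≈⟨ solve 0 (:- (con (+ 0) :+ con (+ 0)) := con (+ 0)) refl ⟩
      0# ∎

    proportional : ∀ {x y s} → ¬ (s ≈ 0#) → L x ≈ s * L y → M x ≈ s * M y → B x ≈ s * B y →
                   _∝_ K x y
    proportional {x} {y} {s} s≉0 l m β = s , s≉0 , coordinates-injective
      (trans l (sym (proj₁ sy))) (trans m (sym (proj₁ (proj₂ sy)))) (trans β (sym (proj₂ (proj₂ sy))))
      where
      sy = scaled {λ i → s * y i} {y} (λ _ → refl)

    -- Colouring the points of the plane

    module _ (k : ℕ) {θ} (independent : Independent (suc k) θ) where

      private
        colours = planeColours k independent
        affine  = planeColour k independent

      -- A point with L ≠ 0, scaled so that L = 1, is coloured by B and M + B², in terms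
      -- of which orthogonality reads (M + B²) + (M′ + B′²) = (B - B′)².
      pointColour : ∀ x → Dec (L x ≈ 0#) → Dec (B x ≈ 0#) → Fin (2 ℕ.+ colours)
      -- On the line L = 0, polar to (a, b, 1), that point itself is the one with B = 0 and gets its
      -- own colour.
      pointColour x (yes _)  (yes _) = zero
      pointColour x (yes _)  (no _)  = suc zero
      pointColour x (no L≉0) _       = let l = proj₁ (invertible (L x) L≉0) in
        suc (suc (affine (l * B x) (l * M x + (l * B x) * (l * B x))))

      pointColour-cong : ∀ {x y} → _∝_ K x y → ∀ d e d′ e′ → pointColour x d e ≡ pointColour y d′ e′
      pointColour-cong {x} {y} (s , s≉0 , eq) = go
        where
        Lx≈ = proj₁ (scaled eq)
        Mx≈ = proj₁ (proj₂ (scaled eq))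
        Bx≈ = proj₂ (proj₂ (scaled eq))

        s*0≈0 : ∀ {u v} → u ≈ s * v → v ≈ 0# → u ≈ 0#
        s*0≈0 e v≈0 = trans e (trans (*-congˡ v≈0) (zeroʳ s))

        go : ∀ d e d′ e′ → pointColour x d e ≡ pointColour y d′ e′
        go (yes _)  (yes _)  (yes _)  (yes _)  = ≡.refl
        go (yes _)  (no _)   (yes _)  (no _)   = ≡.refl
        go (yes _)  (yes Bx) (yes _)  (no By)  = contradiction (cancel s≉0 (trans (sym Bx≈) Bx)) By
        go (yes _)  (no Bx)  (yes _)  (yes By) = contradiction (s*0≈0 Bx≈ By) Bx
        go (yes Lx) _        (no Ly)  _        = contradiction (cancel s≉0 (trans (sym Lx≈) Lx)) Ly
        go (no Lx)  _        (yes Ly) _        = contradiction (s*0≈0 Lx≈ Ly) Lx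
        go (no Lx)  _        (no Ly)  _        = ≡.cong (λ i → Fin.suc (Fin.suc i))
          (planeColour-cong k independent (normalise Bx≈)
            (+-cong (normalise Mx≈) (*-cong (normalise Bx≈) (normalise Bx≈))))
          where
          l  = proj₁ (invertible (L x) Lx)
          l′ = proj₁ (invertible (L y) Ly)

          -- As L x = s L y, the normalising factors 1 / L x and 1 / L y absorb the scalar `s`.
          l*s≈l′ : l * s ≈ l′
          l*s≈l′ = begin
            l * s                 ≈⟨ *-identityʳ _ ⟨
            (l * s) * 1#          ≈⟨ *-congˡ (proj₂ (invertible (L y) Ly)) ⟨
            (l * s) * (L y * l′)  ≈⟨ solve 4 (λ l s L l′ → (l :* s) :* (L :* l′) := ((s :* L) :* l) :* l′) refl l s (L y) l′ ⟩
            ((s * L y) * l) * l′  ≈⟨ *-congʳ (*-congʳ Lx≈) ⟨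
            (L x * l) * l′        ≈⟨ *-congʳ (proj₂ (invertible (L x) Lx)) ⟩
            1# * l′               ≈⟨ *-identityˡ _ ⟩
            l′                    ∎

          normalise : ∀ {u v} → u ≈ s * v → l * u ≈ l′ * v
          normalise e = trans (*-congˡ e) (trans (sym (*-assoc _ _ _)) (*-congʳ l*s≈l′))

      pointColour-proper : ∀ {x y} → Nonzero K x → Nonzero K y → ¬ (_∝_ K x y) → dot K x y ≈ 0# →
        ∀ d e d′ e′ → pointColour x d e ≢ pointColour y d′ e′
      -- A nonzero vector with L = B = 0 has M ≠ 0, so two such vectors are proportional: the colour
      -- class is a single point.
      pointColour-proper {x} {y} x≉0 y≉0 x≢y x⊥y (yes Lx) (yes Bx) (yes Ly) (yes By) _ =
        x≢y (proportional s≉0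
          (trans Lx (sym (trans (*-congˡ Ly) (zeroʳ s)))) Mx≈ (trans Bx (sym (trans (*-congˡ By) (zeroʳ s)))))
        where
        M≉0 : ∀ {z} → Nonzero K z → L z ≈ 0# → B z ≈ 0# → ¬ (M z ≈ 0#)
        M≉0 {z} z≉0 Lz Bz Mz = z≉0 λ i → let L0 , M0 , B0 = scaled {λ _ → 0#} {z} (λ _ → sym (zeroˡ _)) in
          coordinates-injective {z} {λ _ → 0#}
            (trans Lz (sym (trans L0 (zeroˡ _)))) (trans Mz (sym (trans M0 (zeroˡ _))))
            (trans Bz (sym (trans B0 (zeroˡ _)))) i

        m = invertible (M y) (M≉0 {y} y≉0 Ly By)
        s = M x * proj₁ m

        Mx≈ : M x ≈ s * M y
        Mx≈ = begin
          M x                       ≈⟨ *-identityʳ _ ⟨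
          M x * 1#                  ≈⟨ *-congˡ (proj₂ m) ⟨
          M x * (M y * proj₁ m)     ≈⟨ solve 3 (λ x y z → x :* (y :* z) := (x :* z) :* y) refl _ _ _ ⟩
          s * M y                   ∎

        s≉0 : ¬ (s ≈ 0#)
        s≉0 s≈0 = M≉0 {x} x≉0 Lx Bx (trans Mx≈ (trans (*-congʳ s≈0) (zeroˡ _)))
      -- On L = 0 orthogonality reads 2 B B′ = 0, which fails for nonzero B and B′.
      pointColour-proper {x} {y} _ _ _ x⊥y (yes Lx) (no Bx) (yes Ly) (no By) _ =
        By (cancel Bx (x+x≈0⇒x≈0 (begin
          B x * B y + B x * B y
            ≈⟨ +-identityʳ _ ⟨
          (B x * B y + B x * B y) + 0#
            ≈⟨ +-congˡ (trans (+-cong (trans (*-congʳ Lx) (zeroˡ _)) (trans (*-congˡ Ly) (zeroʳ _))) (+-identityʳ 0#)) ⟨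
          (B x * B y + B x * B y) + (L x * M y + M x * L y)
            ≈⟨ orthogonal x y x⊥y ⟩
          0# ∎)))
      -- Equal colours of adjacent points make their normalised coordinates agree, so the points
      -- coincide.
      pointColour-proper {x} {y} _ _ x≢y x⊥y (no Lx) _ (no Ly) _ e = x≢y (proportional s≉0
        Lx≈ (coordinate (M x) (M y) m≈m′) (coordinate (B x) (B y) β≈β′))
        where
        l  = proj₁ (invertible (L x) Lx)
        l′ = proj₁ (invertible (L y) Ly)
        Ll≈1 = proj₂ (invertible (L x) Lx)
        Ll′≈1 = proj₂ (invertible (L y) Ly)
        s  = L x * l′
        β  = l * B x
        β′ = l′ * B y

        adjacent : (l * M x + β * β) + (l′ * M y + β′ * β′) ≈ (β - β′) * (β - β′)
        adjacent = begin
          (l * M x + β * β) + (l′ * M y + β′ * β′)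
            -- The inserted factors L y l′ = 1 and L x l = 1 turn the claim into a polynomial
            -- identity up to l l′ times the form.
            ≈⟨ +-cong (+-congʳ (unit Ll′≈1)) (+-congʳ (unit Ll≈1)) ⟨
          ((L y * l′) * (l * M x) + β * β) + ((L x * l) * (l′ * M y) + β′ * β′)
            ≈⟨ solve 8 (λ l l′ L L′ M M′ B B′ →
                 ((L′ :* l′) :* (l :* M) :+ (l :* B) :* (l :* B)) :+
                   ((L :* l) :* (l′ :* M′) :+ (l′ :* B′) :* (l′ :* B′)) :=
                 (l :* B :- l′ :* B′) :* (l :* B :- l′ :* B′) :+
                   (l :* l′) :* ((B :* B′ :+ B :* B′) :+ (L :* M′ :+ M :* L′))) refl
                 l l′ (L x) (L y) (M x) (M y) (B x) (B y) ⟩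
          (β - β′) * (β - β′) + (l * l′) * ((B x * B y + B x * B y) + (L x * M y + M x * L y))
            ≈⟨ +-congˡ (trans (*-congˡ (orthogonal x y x⊥y)) (zeroʳ _)) ⟩
          (β - β′) * (β - β′) + 0#
            ≈⟨ +-identityʳ _ ⟩
          (β - β′) * (β - β′) ∎
          where
          unit : ∀ {u v} → u ≈ 1# → u * v ≈ v
          unit e = trans (*-congʳ e) (*-identityˡ _)

        same = planeColour-proper k independent adjacent (Finₚ.suc-injective (Finₚ.suc-injective e))
        β≈β′ = proj₁ same

        m≈m′ : l * M x ≈ l′ * M y
        m≈m′ = begin
          l * M x                             ≈⟨ solve 2 (λ m q → m := (m :+ q) :- q) refl _ (β * β) ⟩
          (l * M x + β * β) - β * β           ≈⟨ +-cong (proj₂ same) (-‿cong (*-cong β≈β′ β≈β′)) ⟩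
          (l′ * M y + β′ * β′) - β′ * β′      ≈⟨ solve 2 (λ m q → (m :+ q) :- q := m) refl _ (β′ * β′) ⟩
          l′ * M y                            ∎

        coordinate : ∀ u v → l * u ≈ l′ * v → u ≈ s * v
        coordinate u v e = begin
          u                   ≈⟨ *-identityˡ u ⟨
          1# * u              ≈⟨ *-congʳ Ll≈1 ⟨
          (L x * l) * u       ≈⟨ *-assoc _ _ _ ⟩
          L x * (l * u)       ≈⟨ *-congˡ e ⟩
          L x * (l′ * v)      ≈⟨ *-assoc _ _ _ ⟨
          s * v               ∎

        Lx≈ : L x ≈ s * L y
        Lx≈ = coordinate (L x) (L y)
          (trans (*-comm _ _) (trans Ll≈1 (trans (sym Ll′≈1) (*-comm _ _))))

        s≉0 : ¬ (s ≈ 0#)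
        s≉0 s≈0 = Lx (trans Lx≈ (trans (*-congʳ s≈0) (zeroˡ _)))
      pointColour-proper _ _ _ _ (yes _) (yes _) (yes _) (no _) ()
      pointColour-proper _ _ _ _ (yes _) (no _) (yes _) (yes _) ()
      pointColour-proper _ _ _ _ (yes _) (yes _) (no _) _ ()
      pointColour-proper _ _ _ _ (yes _) (no _) (no _) _ ()
      pointColour-proper _ _ _ _ (no _) _ (yes _) (yes _) ()
      pointColour-proper _ _ _ _ (no _) _ (yes _) (no _) ()

      colourable : Colourable (ER K) (2 ℕ.+ colours)
      colourable = record
        { to   = λ (x , _) → pointColour x (L x ≈? 0#) (B x ≈? 0#)
        ; cong = λ x∝y → pointColour-cong x∝y _ _ _ _
        } , λ { {x , x≉0} {y , y≉0} (x≢y , x⊥y) → pointColour-proper x≉0 y≉0 x≢y x⊥y _ _ _ _ }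

-- Numerical estimates

open import Data.Nat.Base using (_+_; _*_; _^_; _∸_; _≤_; _<_)

toℚᵘ-fromℕ : ∀ n → ℚ.toℚᵘ (fromℕ n) ℚᵘ.≃ ℚᵘ.mkℚᵘ (+ n) 0
toℚᵘ-fromℕ n = ℚₚ.toℚᵘ-fromℚᵘ (ℚᵘ.mkℚᵘ (+ n) 0)

fromℕ-mono-≤ : ∀ {m n} → m ≤ n → fromℕ m ℚ.≤ fromℕ n
fromℕ-mono-≤ {m} {n} m≤n = ℚₚ.toℚᵘ-cancel-≤ (ℚᵘₚ.≤-respˡ-≃ (ℚᵘₚ.≃-sym (toℚᵘ-fromℕ m))
  (ℚᵘₚ.≤-respʳ-≃ (ℚᵘₚ.≃-sym (toℚᵘ-fromℕ n))
    (ℚᵘ.*≤* (ℤₚ.*-monoʳ-≤-nonNeg (+ 1) (ℤ.+≤+ m≤n)))))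

fromℕ-* : ∀ m n → fromℕ m ℚ.* fromℕ n ≡ fromℕ (m * n)
fromℕ-* m n = ℚₚ.toℚᵘ-injective (begin
  ℚ.toℚᵘ (fromℕ m ℚ.* fromℕ n)                    ≈⟨ ℚₚ.toℚᵘ-homo-* (fromℕ m) (fromℕ n) ⟩
  ℚ.toℚᵘ (fromℕ m) ℚᵘ.* ℚ.toℚᵘ (fromℕ n)          ≈⟨ ℚᵘₚ.*-cong (toℚᵘ-fromℕ m) (toℚᵘ-fromℕ n) ⟩
  ℚᵘ.mkℚᵘ (+ m) 0 ℚᵘ.* ℚᵘ.mkℚᵘ (+ n) 0            ≡⟨ ≡.cong (λ i → ℚᵘ.mkℚᵘ i 0) (ℤₚ.pos-* m n) ⟨
  ℚᵘ.mkℚᵘ (+ (m * n)) 0                           ≈⟨ toℚᵘ-fromℕ (m * n) ⟨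
  ℚ.toℚᵘ (fromℕ (m * n))                          ∎)
  where open ℚᵘₚ.≃-Reasoning

thirds-≤ : ∀ {n a x y} → n * 3 ≤ a * x + y * 3 →
  fromℕ n ℚ.≤ (+ a ℚ./ 3) ℚ.* fromℕ x ℚ.+ fromℕ y
thirds-≤ {n} {a} {x} {y} h = ℚₚ.toℚᵘ-cancel-≤ (begin
  ℚ.toℚᵘ (fromℕ n)                  ≃⟨ toℚᵘ-fromℕ n ⟩
  ℚᵘ.mkℚᵘ (+ n) 0                   ≤⟨ ℚᵘ.*≤* integers ⟩
  ℚᵘ.mkℚᵘ (+ a) 2 ℚᵘ.* ℚᵘ.mkℚᵘ (+ x) 0 ℚᵘ.+ ℚᵘ.mkℚᵘ (+ y) 0
    ≃⟨ ℚᵘₚ.+-cong (ℚᵘₚ.*-cong (ℚₚ.toℚᵘ-fromℚᵘ (ℚᵘ.mkℚᵘ (+ a) 2)) (toℚᵘ-fromℕ x)) (toℚᵘ-fromℕ y) ⟨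
  ℚ.toℚᵘ (+ a ℚ./ 3) ℚᵘ.* ℚ.toℚᵘ (fromℕ x) ℚᵘ.+ ℚ.toℚᵘ (fromℕ y)
    ≃⟨ ℚᵘₚ.+-congˡ (ℚ.toℚᵘ (fromℕ y)) (ℚₚ.toℚᵘ-homo-* (+ a ℚ./ 3) (fromℕ x)) ⟨
  ℚ.toℚᵘ ((+ a ℚ./ 3) ℚ.* fromℕ x) ℚᵘ.+ ℚ.toℚᵘ (fromℕ y)
    ≃⟨ ℚₚ.toℚᵘ-homo-+ ((+ a ℚ./ 3) ℚ.* fromℕ x) (fromℕ y) ⟨
  ℚ.toℚᵘ ((+ a ℚ./ 3) ℚ.* fromℕ x ℚ.+ fromℕ y) ∎)
  where
  open ℚᵘₚ.≤-Reasoning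

  integers : + n ℤ.* + 3 ℤ.≤ (+ a ℤ.* + x ℤ.* + 1 ℤ.+ + y ℤ.* + 3) ℤ.* + 1
  integers = ≡.subst₂ ℤ._≤_ (ℤₚ.pos-* n 3)
    (≡.sym (≡.trans (ℤₚ.*-identityʳ _) (≡.cong₂ ℤ._+_
      (≡.trans (ℤₚ.*-identityʳ _) (≡.sym (ℤₚ.pos-* a x))) (≡.sym (ℤₚ.pos-* y 3)))))
    (ℤ.+≤+ h)

-- Otherwise t < a and t³ < a³ ≤ m ≤ t³. This brings a natural number below every rational upper
-- bound of a cube root.
cubeRoot-≤ : ∀ {a m t} → a * (a * a) ≤ m → ℚ.0ℚ ℚ.≤ t → fromℕ m ℚ.≤ t ^ℚ 3 → fromℕ a ℚ.≤ t
cubeRoot-≤ {a} {m} {t} a³≤m 0≤t m≤t³ = ℚₚ.≮⇒≥ λ t<s → ℚₚ.<-irrefl ≡.refl (begin-strict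
  t ^ℚ 3              ≡⟨ ≡.cong (λ u → t ℚ.* (t ℚ.* u)) (ℚₚ.*-identityʳ t) ⟩
  t ℚ.* (t ℚ.* t)     ≤⟨ *-monoˡ 0≤t (ℚₚ.≤-trans (*-monoˡ 0≤t (ℚₚ.<⇒≤ t<s)) (*-monoʳ (0≤s t<s) (ℚₚ.<⇒≤ t<s))) ⟩
  t ℚ.* (s ℚ.* s)     <⟨ ℚₚ.*-monoˡ-<-pos (s ℚ.* s) {{0<s² t<s}} t<s ⟩
  s ℚ.* (s ℚ.* s)     ≡⟨ ≡.cong (s ℚ.*_) (fromℕ-* a a) ⟩
  s ℚ.* fromℕ (a * a) ≡⟨ fromℕ-* a (a * a) ⟩
  fromℕ (a * (a * a)) ≤⟨ fromℕ-mono-≤ a³≤m ⟩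
  fromℕ m             ≤⟨ m≤t³ ⟩
  t ^ℚ 3              ∎)
  where
  open ℚₚ.≤-Reasoning
  s = fromℕ a

  *-monoˡ : ∀ {r p q} → ℚ.0ℚ ℚ.≤ r → p ℚ.≤ q → r ℚ.* p ℚ.≤ r ℚ.* q
  *-monoˡ {r} 0≤r = ℚₚ.*-monoˡ-≤-nonNeg r {{ℚ.nonNegative 0≤r}}

  *-monoʳ : ∀ {r p q} → ℚ.0ℚ ℚ.≤ r → p ℚ.≤ q → p ℚ.* r ℚ.≤ q ℚ.* r
  *-monoʳ {r} 0≤r = ℚₚ.*-monoʳ-≤-nonNeg r {{ℚ.nonNegative 0≤r}}

  0≤s : t ℚ.< s → ℚ.0ℚ ℚ.≤ s
  0≤s t<s = ℚₚ.≤-trans 0≤t (ℚₚ.<⇒≤ t<s)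

  0<s² : t ℚ.< s → ℚ.Positive (s ℚ.* s)
  0<s² t<s = ℚₚ.pos*pos⇒pos s {{s>0}} s {{s>0}}
    where s>0 = ℚ.positive (ℚₚ.≤-<-trans 0≤t t<s)

-- The bound in terms of p, N and k

n<m^n : ∀ {m} → 1 < m → ∀ n → n < m ^ n
n<m^n 1<m zero    = s≤s z≤n
n<m^n {m} 1<m (suc n) = begin-strict
  suc n             ≤⟨ n<m^n 1<m n ⟩
  m ^ n             <⟨ ℕₚ.^-monoʳ-< m 1<m (ℕₚ.n<1+n n) ⟩
  m ^ suc n         ∎
  where open ℕₚ.≤-Reasoning

1+k≤3k+2 : ∀ k → suc k ≤ 3 * k + 2
1+k≤3k+2 k = begin
  suc k                   ≤⟨ ℕₚ.m≤m+n (suc k) (2 * k + 1) ⟩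
  suc k + (2 * k + 1)     ≡⟨ solve 1 (λ k → con 1 :+ k :+ (con 2 :* k :+ con 1) := con 3 :* k :+ con 2) ≡.refl k ⟩
  3 * k + 2               ∎
  where
  open ℕₚ.≤-Reasoning
  open +-*-Solver

-- As k < pᵏ, `3 * k + 2 ≤ N` gives p²ᵏ⁺² k < p³ᵏ⁺² ≤ Q, so θ exists. The bound adds up two signs
-- for each of at most pᴺ⁻ᵏ⁻¹ cosets of W, 2 p²ᵏ⁺¹ + 1 greedy colours, and two colours for L = 0.
chromaticNumber-≤ : ∀ {c ℓ p Q N k} (K : FiniteField c ℓ Q) → Prime p → Odd p → Q ≡ p ^ N →
  3 * k + 2 ≤ N → χ (ER K) ≤ 2 * p ^ (N ∸ suc k) + 2 * p ^ suc (k + k) + 3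
chromaticNumber-≤ {p = p} {Q} {N} {k} K p-prime p-odd Q≡p^N 3k+2≤N = begin
  χ (ER K)
    ≤⟨ proj₂ (proj₂ (chromaticNumber (ER K))) _ (colourable k {θ} independent) ⟩
  2 + (cosets * 2 + suc (2 * p ^ suc (k + k)))
    ≤⟨ ℕₚ.+-monoʳ-≤ 2 (ℕₚ.+-monoˡ-≤ _ (ℕₚ.*-monoˡ-≤ 2 cosets≤)) ⟩
  2 + (p ^ (N ∸ suc k) * 2 + suc (2 * p ^ suc (k + k)))
    ≡⟨ solve 2 (λ a b → con 2 :+ (a :* con 2 :+ (con 1 :+ con 2 :* b)) := con 2 :* a :+ con 2 :* b :+ con 3)
         ≡.refl (p ^ (N ∸ suc k)) (p ^ suc (k + k)) ⟩
  2 * p ^ (N ∸ suc k) + 2 * p ^ suc (k + k) + 3 ∎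
  where
  open ℕₚ.≤-Reasoning
  open +-*-Solver

  instance
    p≢0 : NonZero p
    p≢0 = prime⇒nonZero p-prime

  p>1 : 1 < p
  p>1 = ℕ.nonTrivial⇒n>1 p {{prime⇒nonTrivial p-prime}}

  open FiniteField K using (trans; reflexive; 1#; semiring)
  open FieldProperties K
  p⋅1≈0 = characteristic p N (trans (reflexive (≡.cong (λ n → Mult._×_ semiring n 1#) (≡.sym Q≡p^N))) order⋅1≈0)

  open OddCharacteristic K p-prime p-odd p⋅1≈0
  open Colouring K p-prime p-odd p⋅1≈0

  few : p ^ suc k * p ^ suc k * k < Q
  few = begin-strict
    p ^ suc k * p ^ suc k * k         <⟨ ℕₚ.*-monoʳ-< (p ^ suc k * p ^ suc k) {{ℕₚ.m*n≢0 _ _ {{ℕₚ.m^n≢0 p (suc k)}} {{ℕₚ.m^n≢0 p (suc k)}}}} (n<m^n p>1 k) ⟩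
    p ^ suc k * p ^ suc k * p ^ k     ≡⟨ ≡.cong (_* p ^ k) (ℕₚ.^-distribˡ-+-* p (suc k) (suc k)) ⟨
    p ^ (suc k + suc k) * p ^ k       ≡⟨ ℕₚ.^-distribˡ-+-* p (suc k + suc k) k ⟨
    p ^ (suc k + suc k + k)           ≡⟨ ≡.cong (p ^_) (solve 1 (λ k → (con 1 :+ k) :+ (con 1 :+ k) :+ k := con 3 :* k :+ con 2) ≡.refl k) ⟩
    p ^ (3 * k + 2)                   ≤⟨ ℕₚ.^-monoʳ-≤ p 3k+2≤N ⟩
    p ^ N                             ≡⟨ Q≡p^N ⟨
    Q                                 ∎

  θ : FiniteField.Carrier K
  θ = proj₁ (independentElement k few)

  independent : Independent (suc k) θ
  independent = proj₂ (independentElement k few)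

  open Coordinates (proj₂ (proj₂ minusOneSumOfSquares))

  cosets = Quotient.classes (Spans.cosets θ (suc k))

  1+k≤N : suc k ≤ N
  1+k≤N = ℕₚ.≤-trans (1+k≤3k+2 k) 3k+2≤N

  cosets≤ : cosets ≤ p ^ (N ∸ suc k)
  cosets≤ = ℕₚ.*-cancelʳ-≤ cosets (p ^ (N ∸ suc k)) (p ^ suc k) {{ℕₚ.m^n≢0 p (suc k)}} (begin
    cosets * p ^ suc k              ≤⟨ Spans.cosets*size≤ θ (suc k) independent ⟩
    Q                               ≡⟨ Q≡p^N ⟩
    p ^ N                           ≡⟨ ≡.cong (p ^_) (ℕₚ.m∸n+n≡m 1+k≤N) ⟨
    p ^ (N ∸ suc k + suc k)         ≡⟨ ℕₚ.^-distribˡ-+-* p (N ∸ suc k) (suc k) ⟩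
    p ^ (N ∸ suc k) * p ^ suc k     ∎)

-- k + 1 = ⌈ 2x / 3 ⌉.
twoThirds : ∀ x → 1 ≤ x → ∃ λ k → 2 * x ≤ 3 * k + 3 × 3 * k + 3 ≤ 2 * x + 2
twoThirds (suc x) _ = k , lower , upper
  where
  open ℕₚ.≤-Reasoning
  open +-*-Solver
  -- For n = 2 * suc x, ⌈n / 3⌉ - 1 is ⌊(n - 1) / 3⌋, and y = n - 1.
  y = 2 * x + 1
  k = y ℕ./ 3
  ρ = y ℕ.% 3

  y≡ : y ≡ ρ + k * 3
  y≡ = ℕ.m≡m%n+[m/n]*n y 3

  lower : 2 * suc x ≤ 3 * k + 3
  lower = begin
    2 * suc x         ≡⟨ solve 1 (λ x → con 2 :* (con 1 :+ x) := con 1 :+ (con 2 :* x :+ con 1)) ≡.refl x ⟩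
    suc y             ≡⟨ ≡.cong suc y≡ ⟩
    suc ρ + k * 3     ≤⟨ ℕₚ.+-monoˡ-≤ (k * 3) (ℕ.m%n<n y 3) ⟩
    3 + k * 3         ≡⟨ solve 1 (λ k → con 3 :+ k :* con 3 := con 3 :* k :+ con 3) ≡.refl k ⟩
    3 * k + 3         ∎

  upper : 3 * k + 3 ≤ 2 * suc x + 2
  upper = begin
    3 * k + 3         ≡⟨ solve 1 (λ k → con 3 :* k :+ con 3 := k :* con 3 :+ con 3) ≡.refl k ⟩
    k * 3 + 3         ≤⟨ ℕₚ.+-monoˡ-≤ 3 (ℕₚ.m≤n+m (k * 3) ρ) ⟩
    ρ + k * 3 + 3     ≡⟨ ≡.cong (_+ 3) y≡ ⟨
    y + 3             ≡⟨ solve 1 (λ x → con 2 :* x :+ con 1 :+ con 3 := con 2 :* (con 1 :+ x) :+ con 2) ≡.refl x ⟩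
    2 * suc x + 2     ∎

-- `A`, `B`, `G` stand for pᴺ⁻ᵏ⁻¹, p²ᵏ⁺¹ and q^(r + 1); both sides are multiplied by 3. If r ≤ 3,
-- then 6 B + 6 ≤ 9 G ≤ 3 (2r + 1) G; if r ≥ 4, then 6 A + 6 B ≤ 12 A ≤ (2r + 5) A.
colours-≤ : ∀ r {A B G} → 1 ≤ r → B ≤ A → (r ≤ 3 → B ≤ G) → 2 ≤ G →
  (2 * A + 2 * B + 3) * 3 ≤ (2 * r + 5) * A + ((2 * r + 1) * G + 1) * 3
colours-≤ (suc r) {A} {B} {G} _ B≤A small 2≤G with suc r ℕₚ.≤? 3
... | yes r≤3 = begin
  (2 * A + 2 * B + 3) * 3
    ≡⟨ solve 2 (λ A B → (con 2 :* A :+ con 2 :* B :+ con 3) :* con 3 :=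
         con 6 :* A :+ con 6 :* B :+ con 3 :* con 2 :+ con 3) ≡.refl A B ⟩
  6 * A + 6 * B + 3 * 2 + 3
    ≤⟨ ℕₚ.+-monoˡ-≤ 3 (ℕₚ.+-mono-≤ (ℕₚ.+-monoʳ-≤ (6 * A) (ℕₚ.*-monoʳ-≤ 6 (small r≤3))) (ℕₚ.*-monoʳ-≤ 3 2≤G)) ⟩
  6 * A + 6 * G + 3 * G + 3
    ≤⟨ ℕₚ.m≤m+n _ (A + 2 * r * A + 6 * r * G) ⟩
  6 * A + 6 * G + 3 * G + 3 + (A + 2 * r * A + 6 * r * G)
    ≡⟨ solve 3 (λ r A G → con 6 :* A :+ con 6 :* G :+ con 3 :* G :+ con 3 :+ (A :+ con 2 :* r :* A :+ con 6 :* r :* G) :=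
         (con 2 :* (con 1 :+ r) :+ con 5) :* A :+ ((con 2 :* (con 1 :+ r) :+ con 1) :* G :+ con 1) :* con 3) ≡.refl r A G ⟩
  (2 * suc r + 5) * A + ((2 * suc r + 1) * G + 1) * 3 ∎
  where
  open ℕₚ.≤-Reasoning
  open +-*-Solver
... | no r≰3 with ℕₚ.m≤n⇒∃[o]m+o≡n (ℕₚ.≰⇒> r≰3)
...   | s , ≡.refl = begin
  (2 * A + 2 * B + 3) * 3
    ≡⟨ solve 2 (λ A B → (con 2 :* A :+ con 2 :* B :+ con 3) :* con 3 :=
         con 6 :* A :+ con 6 :* B :+ con 3 :* con 2 :+ con 3) ≡.refl A B ⟩
  6 * A + 6 * B + 3 * 2 + 3
    ≤⟨ ℕₚ.+-monoˡ-≤ 3 (ℕₚ.+-mono-≤ (ℕₚ.+-monoʳ-≤ (6 * A) (ℕₚ.*-monoʳ-≤ 6 B≤A)) (ℕₚ.*-monoʳ-≤ 3 2≤G)) ⟩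
  6 * A + 6 * A + 3 * G + 3
    ≤⟨ ℕₚ.m≤m+n _ (A + 2 * s * A + 24 * G + 6 * s * G) ⟩
  6 * A + 6 * A + 3 * G + 3 + (A + 2 * s * A + 24 * G + 6 * s * G)
    ≡⟨ solve 3 (λ s A G → con 6 :* A :+ con 6 :* A :+ con 3 :* G :+ con 3 :+ (A :+ con 2 :* s :* A :+ con 24 :* G :+ con 6 :* s :* G) :=
         (con 2 :* (con 4 :+ s) :+ con 5) :* A :+ ((con 2 :* (con 4 :+ s) :+ con 1) :* G :+ con 1) :* con 3) ≡.refl s A G ⟩
  (2 * (4 + s) + 5) * A + ((2 * (4 + s) + 1) * G + 1) * 3 ∎
  where
  open ℕₚ.≤-Reasoning
  open +-*-Solver

-- Exponent estimates for k + 1 = ⌈2re / 3⌉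

module Exponents {r e k} (1≤e : 1 ≤ e) (lower : 2 * (r * e) ≤ 3 * k + 3) (upper : 3 * k + 3 ≤ 2 * (r * e) + 2) where
  open ℕₚ.≤-Reasoning
  open +-*-Solver

  N f : ℕ
  N = e * (2 * r + 1)
  f = N ∸ suc k

  N≡ : N ≡ 2 * (r * e) + e
  N≡ = solve 2 (λ r e → e :* (con 2 :* r :+ con 1) := con 2 :* (r :* e) :+ e) ≡.refl r e

  3k+2≤N : 3 * k + 2 ≤ N
  3k+2≤N = ℕₚ.+-cancelʳ-≤ 1 _ _ (begin
    3 * k + 2 + 1         ≡⟨ ℕₚ.+-assoc (3 * k) 2 1 ⟩
    3 * k + 3             ≤⟨ upper ⟩
    2 * (r * e) + 2       ≤⟨ ℕₚ.+-monoʳ-≤ (2 * (r * e)) (ℕₚ.+-monoˡ-≤ 1 1≤e) ⟩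
    2 * (r * e) + (e + 1) ≡⟨ ℕₚ.+-assoc (2 * (r * e)) e 1 ⟨
    2 * (r * e) + e + 1   ≡⟨ ≡.cong (_+ 1) N≡ ⟨
    N + 1                 ∎)

  1+2k≤f : suc (k + k) ≤ f
  1+2k≤f = ℕₚ.m+n≤o⇒m≤o∸n _ (begin
    suc (k + k) + suc k   ≡⟨ solve 1 (λ k → con 1 :+ (k :+ k) :+ (con 1 :+ k) := con 3 :* k :+ con 2) ≡.refl k ⟩
    3 * k + 2             ≤⟨ 3k+2≤N ⟩
    N                     ∎)

  -- 3f = 3N - 3 (k + 1) and 3 (k + 1) ≥ 2re. Rounding k + 1 up thus keeps p^f below q^(4r/3 + 1)
  -- for q = pᵉ.
  3f≤ : f + (f + f) ≤ e * (4 * r + 3)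
  3f≤ = ℕₚ.+-cancelʳ-≤ (3 * k + 3) _ _ (begin
    f + (f + f) + (3 * k + 3)
      ≡⟨ solve 2 (λ f k → f :+ (f :+ f) :+ (con 3 :* k :+ con 3) := con 3 :* (f :+ (con 1 :+ k))) ≡.refl f k ⟩
    3 * (f + suc k)
      ≡⟨ ≡.cong (3 *_) (ℕₚ.m∸n+n≡m (ℕₚ.≤-trans (1+k≤3k+2 k) 3k+2≤N)) ⟩
    3 * N
      ≡⟨ solve 2 (λ r e → con 3 :* (e :* (con 2 :* r :+ con 1)) := e :* (con 4 :* r :+ con 3) :+ con 2 :* (r :* e)) ≡.refl r e ⟩
    e * (4 * r + 3) + 2 * (r * e)
      ≤⟨ ℕₚ.+-monoʳ-≤ (e * (4 * r + 3)) lower ⟩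
    e * (4 * r + 3) + (3 * k + 3) ∎)

  -- `upper` gives 3 (2k + 1) ≤ 4re + 1, and re ≤ 3e, so 3 (2k + 1) ≤ 3e (r + 1) + 1. The surplus 1
  -- is lost on dividing by 3, hence the detour through a strict inequality.
  1+2k≤e[r+1] : r ≤ 3 → suc (k + k) ≤ e * (r + 1)
  1+2k≤e[r+1] r≤3 = ℕ.s≤s⁻¹ (ℕₚ.*-cancelˡ-< 3 _ _ (ℕₚ.+-cancelʳ-< 3 _ _ (begin-strict
    3 * suc (k + k) + 3
      ≡⟨ solve 1 (λ k → con 3 :* (con 1 :+ (k :+ k)) :+ con 3 := con 2 :* (con 3 :* k :+ con 3)) ≡.refl k ⟩
    2 * (3 * k + 3)
      ≤⟨ ℕₚ.*-monoʳ-≤ 2 upper ⟩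
    2 * (2 * (r * e) + 2)
      ≡⟨ solve 1 (λ x → con 2 :* (con 2 :* x :+ con 2) := con 3 :* x :+ x :+ con 4) ≡.refl (r * e) ⟩
    3 * (r * e) + r * e + 4
      ≤⟨ ℕₚ.+-monoˡ-≤ 4 (ℕₚ.+-monoʳ-≤ (3 * (r * e)) (ℕₚ.*-monoˡ-≤ e r≤3)) ⟩
    3 * (r * e) + 3 * e + 4
      <⟨ ℕₚ.+-monoʳ-< (3 * (r * e) + 3 * e) (s≤s (s≤s (s≤s (s≤s (s≤s z≤n))))) ⟩
    3 * (r * e) + 3 * e + 6
      ≡⟨ solve 2 (λ r e → con 3 :* (r :* e) :+ con 3 :* e :+ con 6 := con 3 :* (con 1 :+ e :* (r :+ con 1)) :+ con 3) ≡.refl r e ⟩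
    3 * suc (e * (r + 1)) + 3 ∎)))

chromaticNumber-≤ℚ : ∀ {c ℓ p e r k t} (K : FiniteField c ℓ ((p ^ e) ^ (2 * r + 1))) →
  Prime p → Odd p → .{{NonZero e}} → 1 ≤ r →
  2 * (r * e) ≤ 3 * k + 3 → 3 * k + 3 ≤ 2 * (r * e) + 2 →
  (p ^ e) ^[ 4 * r + 3 / 3 ]≤ t →
  fromℕ (χ (ER K)) ℚ.≤
    (+ (2 * r + 5) ℚ./ 3) ℚ.* t ℚ.+ fromℕ ((2 * r + 1) * (p ^ e) ^ (r + 1) + 1)
chromaticNumber-≤ℚ {p = p} {e@(suc _)} {r} {k} {t} K p-prime p-odd 1≤r lower upper (0≤t , q^≤t³) = begin
  fromℕ (χ (ER K))
    ≤⟨ fromℕ-mono-≤ {n = 2 * A + 2 * B + 3} (chromaticNumber-≤ {N = N} {k} K p-prime p-odd (ℕₚ.^-*-assoc p e (2 * r + 1)) 3k+2≤N) ⟩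
  fromℕ (2 * A + 2 * B + 3)
    ≤⟨ thirds-≤ {2 * A + 2 * B + 3} {2 * r + 5} {A} {Y} (colours-≤ r 1≤r B≤A B≤G 2≤G) ⟩
  (+ (2 * r + 5) ℚ./ 3) ℚ.* fromℕ A ℚ.+ fromℕ Y
    ≤⟨ ℚₚ.+-monoˡ-≤ (fromℕ Y) (ℚₚ.*-monoˡ-≤-nonNeg (+ (2 * r + 5) ℚ./ 3)
         {{ℚₚ.normalize-nonNeg (2 * r + 5) 3}} A≤t) ⟩
  (+ (2 * r + 5) ℚ./ 3) ℚ.* t ℚ.+ fromℕ Y ∎
  where
  open ℚₚ.≤-Reasoning
  open Exponents {r} {e} {k} (s≤s z≤n) lower upper

  instance
    p≢0 : NonZero p
    p≢0 = prime⇒nonZero p-prime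

  A B G Y : ℕ
  A = p ^ f
  B = p ^ suc (k + k)
  G = (p ^ e) ^ (r + 1)
  Y = (2 * r + 1) * G + 1

  B≤A : B ≤ A
  B≤A = ℕₚ.^-monoʳ-≤ p 1+2k≤f

  G≡ : G ≡ p ^ (e * (r + 1))
  G≡ = ℕₚ.^-*-assoc p e (r + 1)

  B≤G : r ≤ 3 → B ≤ G
  B≤G r≤3 = ≡.subst (B ≤_) (≡.sym G≡) (ℕₚ.^-monoʳ-≤ p (1+2k≤e[r+1] r≤3))

  2≤G : 2 ≤ G
  2≤G = ≡.subst (2 ≤_) (≡.sym G≡) (ℕₚ.≤-trans (ℕ.nonTrivial⇒n>1 p {{prime⇒nonTrivial p-prime}})
    (≡.subst (_≤ p ^ (e * (r + 1))) (ℕₚ.^-identityʳ p)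
      (ℕₚ.^-monoʳ-≤ p (ℕₚ.*-mono-≤ {1} {e} {1} (s≤s z≤n) (ℕₚ.m≤n+m 1 r)))))

  A³≤ : A * (A * A) ≤ (p ^ e) ^ (4 * r + 3)
  A³≤ = ≡.subst₂ _≤_
    (≡.trans (ℕₚ.^-distribˡ-+-* p f (f + f)) (≡.cong (A *_) (ℕₚ.^-distribˡ-+-* p f f)))
    (≡.sym (ℕₚ.^-*-assoc p e (4 * r + 3)))
    (ℕₚ.^-monoʳ-≤ p 3f≤)

  A≤t : fromℕ A ℚ.≤ t
  A≤t = cubeRoot-≤ {A} A³≤ 0≤t q^≤t³

theorem1p2 :
  ∀ {c ℓ c′ ℓ′} (q r : ℕ) → OddPowerOfOddPrime q → 1 ≤ r →
  (F : FiniteField c ℓ q) (K : FiniteField c′ ℓ′ (q ^ (2 * r + 1))) →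
  let open FiniteField F using (Carrier)
      open Polynomial (FiniteField.commutativeRing F) using (Irreducible)
      open Polynomial (FiniteField.commutativeRing F) using (X^_-_) in
  (∃ λ (μ : Carrier) → Irreducible (X^ (2 * r + 1) - μ)) →
  ∀ (t : ℚ.ℚ) → q ^[ 4 * r + 3 / 3 ]≤ t →
  fromℕ (χ (ER K)) ℚ.≤
    (+ (2 * r + 5) ℚ./ 3) ℚ.* t ℚ.+ fromℕ ((2 * r + 1) * q ^ (r + 1) + 1)
-- 2 divides 0, so e = 0 is excluded and re ≥ 1, as `twoThirds` requires.
theorem1p2 q r (p , zero , _ , _ , odd-e , _) _ _ _ _ _ _ = contradiction (ℕ.divides 0 ≡.refl) odd-e
theorem1p2 q r (p , e@(suc _) , p-prime , p-odd , _ , ≡.refl) 1≤r _ K _ t q^≤t =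
  let k , lower , upper = twoThirds (r * e) (ℕₚ.*-mono-≤ 1≤r (s≤s z≤n))
  in chromaticNumber-≤ℚ {e = e} {r} {k} K p-prime p-odd 1≤r lower upper q^≤t
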